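{- Let $\delta$ be a Berkeley cardinal and let $\langle\mathcal{M}_\delta,\mathcal{R}\rangle$ be the associated potentialist system. Then $\mathcal{M}_\delta$ provides a potentialist account of the universe $V$: every world $M\in\mathcal{M}_\delta$ (as $\langle M,\in\rangle$) is a substructure of $\langle V,\in\rangle$, and for every $M\in\mathcal{M}_\delta$ and every set $a$ there is $N\in\mathcal{M}_\delta$ with $M\mathcal{R}N$ and $a\in N$.
   Context: Background theory: ZF (no Axiom of Choice). Berkeley cardinal: a cardinal $\delta$ is Berkeley if for every transitive set $M$ with $\delta\in M$ and every ordinal $\eta<\delta$ there is a non-trivial elementary embedding $j:M\to M$ (of $\langle M,\in\rangle$) with $\eta<\mathrm{crit}(j)<\delta$; non-trivial means $j$ is not the identity on the ordinals. The system: $\mathcal{M}_\delta$ is the class of all transitive sets $M$ with $\delta\in M$ (the "worlds", viewed as structures $\langle M,\in\rangle$). For $M,N\in\mathcal{M}_\delta$, $M\mathcal{R}N$ ("$M$ accesses $N$") iff $M\subseteq N$ and for every elementary embedding $j:N\to N$ (trivial or not), the restriction $j\restriction M$ is an elementary embedding from $M$ to $M$. -}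

module Defs where

open import Data.Fin.Base using (Fin)
open import Data.Nat.Base using (ℕ; zero; suc)
open import Data.Product using (∃; ∃-syntax; _×_)
open import Data.Sum.Base using (_⊎_)
open import Data.Unit.Polymorphic.Base using (⊤)
open import Data.Vec.Base using (Vec; _∷_; lookup)
open import Function.Bundles using (_⇔_)
open import Level using (Level) renaming (suc to lsuc)
open import Relation.Binary.PropositionalEquality using (_≡_; _≢_)
open import Relation.Nullary using (¬_; Dec)

record Universe (ℓ : Level) : Set (lsuc ℓ) where
  infix 6 _∈_
  field
    V   : Set ℓ
    _∈_ : V → V → Set ℓ

-- First-order formulas of set theory with free (de Bruijn) variables in Fin n.
-- They are used only to state the axiom schemas; formulas to be interpreted in
-- set-sized structures are coded by elements of V below.
data Formula (n : ℕ) : Set where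
  _∈′_ _≡′_           : Fin n → Fin n → Formula n
  ¬′_                 : Formula n → Formula n
  _∧′_ _∨′_ _⇒′_ _⇔′_ : Formula n → Formula n → Formula n
  ∀′_ ∃′_             : Formula (suc n) → Formula n

module SetTheory {ℓ : Level} (𝓥 : Universe ℓ) where

  open Universe 𝓥 public

  infix 4 _⊨_

  _⊨_ : ∀ {n} → Vec V n → Formula n → Set ℓ
  ρ ⊨ (i ∈′ j) = lookup ρ i ∈ lookup ρ j
  ρ ⊨ (i ≡′ j) = lookup ρ i ≡ lookup ρ j
  ρ ⊨ (¬′ φ)   = ¬ (ρ ⊨ φ)
  ρ ⊨ (φ ∧′ ψ) = (ρ ⊨ φ) × (ρ ⊨ ψ)
  ρ ⊨ (φ ∨′ ψ) = (ρ ⊨ φ) ⊎ (ρ ⊨ ψ)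
  ρ ⊨ (φ ⇒′ ψ) = (ρ ⊨ φ) → (ρ ⊨ ψ)
  ρ ⊨ (φ ⇔′ ψ) = (ρ ⊨ φ) ⇔ (ρ ⊨ ψ)
  ρ ⊨ (∀′ φ)   = ∀ x → (x ∷ ρ) ⊨ φ
  ρ ⊨ (∃′ φ)   = ∃[ x ] ((x ∷ ρ) ⊨ φ)

  -- All predicates on V below are built from ∈ and ≡ by the connectives and
  -- quantifiers interpreted above, so each is the interpretation of a Formula.

  infix 6 _⊆_ _∋⟨_,_⟩

  _⊆_ : V → V → Set ℓ
  x ⊆ y = ∀ z → z ∈ x → z ∈ y

  IsEmpty : V → Set ℓ
  IsEmpty x = ∀ y → ¬ (y ∈ x)

  -- p = {x , y}
  IsUPair : V → V → V → Set ℓ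
  IsUPair p x y = ∀ z → z ∈ p ⇔ (z ≡ x ⊎ z ≡ y)

  -- p = ⟨x , y⟩ = {{x} , {x , y}}
  IsPair : V → V → V → Set ℓ
  IsPair p x y = ∃[ a ] ∃[ b ] (IsUPair a x x × IsUPair b x y × IsUPair p a b)

  -- y = x ∪ {x}
  IsSucc : V → V → Set ℓ
  IsSucc y x = ∀ z → z ∈ y ⇔ (z ∈ x ⊎ z ≡ x)

  IsInductive : V → Set ℓ
  IsInductive X = (∃[ e ] (IsEmpty e × e ∈ X))
                × (∀ x → x ∈ X → ∃[ y ] (IsSucc y x × y ∈ X))

  -- Classical ZF.  Reasoning in the Agda metatheory is constructive, so excluded
  -- middle for first-order formulas is listed along with the axioms.  Separation
  -- and Replacement range over first-order formulas only: schemas for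
  -- arbitrary Agda relations could import choice from the metatheory.
  record IsZF : Set ℓ where
    field
      excludedMiddle : ∀ {n} (φ : Formula n) (ρ : Vec V n) → Dec (ρ ⊨ φ)
      extensionality : ∀ x y → (∀ z → z ∈ x ⇔ z ∈ y) → x ≡ y
      foundation     : ∀ x → (∃[ y ] y ∈ x) →
                       ∃[ y ] (y ∈ x × (∀ z → z ∈ y → ¬ (z ∈ x)))
      pairing        : ∀ x y → ∃[ p ] IsUPair p x y
      union          : ∀ x → ∃[ u ] (∀ z → z ∈ u ⇔ (∃[ y ] (y ∈ x × z ∈ y)))
      powerset       : ∀ x → ∃[ p ] (∀ z → z ∈ p ⇔ z ⊆ x)
      infinity       : ∃[ X ] IsInductive X
      separation     : ∀ {n} (φ : Formula (suc n)) (ρ : Vec V n) (a : V) →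
                       ∃[ b ] (∀ x → x ∈ b ⇔ (x ∈ a × ((x ∷ ρ) ⊨ φ)))
      replacement    : ∀ {n} (φ : Formula (suc (suc n))) (ρ : Vec V n) (a : V) →
                       (∀ x y y′ → x ∈ a → (x ∷ y ∷ ρ) ⊨ φ →
                                   (x ∷ y′ ∷ ρ) ⊨ φ → y ≡ y′) →
                       ∃[ b ] (∀ y → y ∈ b ⇔ (∃[ x ] (x ∈ a × ((x ∷ y ∷ ρ) ⊨ φ))))

  -- f ∋⟨ x , y ⟩ is ⟨x , y⟩ ∈ f; for a function f it says f(x) = y.
  _∋⟨_,_⟩ : V → V → V → Set ℓ
  f ∋⟨ x , y ⟩ = ∃[ p ] (IsPair p x y × p ∈ f)

  IsFunction : V → V → V → Set ℓ
  IsFunction f A B = (∀ p → p ∈ f → ∃[ x ] ∃[ y ] (x ∈ A × y ∈ B × IsPair p x y))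
                   × (∀ x → x ∈ A → ∃[ y ] f ∋⟨ x , y ⟩)
                   × (∀ x y y′ → f ∋⟨ x , y ⟩ → f ∋⟨ x , y′ ⟩ → y ≡ y′)

  IsBijection : V → V → V → Set ℓ
  IsBijection f A B = IsFunction f A B
                    × (∀ x x′ y → f ∋⟨ x , y ⟩ → f ∋⟨ x′ , y ⟩ → x ≡ x′)
                    × (∀ y → y ∈ B → ∃[ x ] f ∋⟨ x , y ⟩)

  -- r = f ↾ A
  IsRestriction : V → V → V → Set ℓ
  IsRestriction r f A =
    ∀ p → p ∈ r ⇔ (p ∈ f × (∃[ x ] ∃[ y ] (x ∈ A × IsPair p x y)))

  IsTransitive : V → Set ℓ
  IsTransitive x = ∀ y → y ∈ x → y ⊆ x

  -- Under Foundation these are exactly the von Neumann ordinals, ordered by ∈.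
  IsOrdinal : V → Set ℓ
  IsOrdinal α = IsTransitive α × (∀ β → β ∈ α → IsTransitive β)

  IsCardinal : V → Set ℓ
  IsCardinal κ = IsOrdinal κ × (∀ α → α ∈ κ → ¬ (∃[ f ] IsBijection f α κ))

  IsNat : V → Set ℓ
  IsNat n = ∀ X → IsInductive X → n ∈ X

  IsOmega : V → Set ℓ
  IsOmega w = ∀ n → n ∈ w ⇔ IsNat n

  IsNumeral : ℕ → V → Set ℓ
  IsNumeral zero    x = IsEmpty x
  IsNumeral (suc k) x = ∃[ y ] (IsNumeral k y × IsSucc x y)

  -- Formulas of the language {∈} as elements of V, with variables vᵢ (i ∈ ω):
  --   ⌜vᵢ ∈ vⱼ⌝ = ⟨0,⟨i,j⟩⟩,  ⌜vᵢ = vⱼ⌝ = ⟨1,⟨i,j⟩⟩,  ⌜¬ φ⌝ = ⟨2,⟨φ,φ⟩⟩,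
  --   ⌜φ ∧ ψ⌝ = ⟨3,⟨φ,ψ⟩⟩,    ⌜∃vᵢ φ⌝ = ⟨4,⟨i,φ⟩⟩.
  -- In each predicate the first argument is the code.
  IsTagged : ℕ → V → V → V → Set ℓ
  IsTagged k c a b =
    ∃[ t ] ∃[ p ] (IsNumeral k t × IsPair p a b × IsPair c t p)

  IsMem IsEq IsAnd IsEx : V → V → V → Set ℓ
  IsMem = IsTagged 0
  IsEq  = IsTagged 1
  IsAnd = IsTagged 3
  IsEx  = IsTagged 4

  IsNot : V → V → Set ℓ
  IsNot c φ = IsTagged 2 c φ φ

  IsFormulaClosed : V → Set ℓ
  IsFormulaClosed X =
      (∀ c i j → IsNat i → IsNat j → IsMem c i j → c ∈ X)
    × (∀ c i j → IsNat i → IsNat j → IsEq c i j → c ∈ X)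
    × (∀ c φ → φ ∈ X → IsNot c φ → c ∈ X)
    × (∀ c φ ψ → φ ∈ X → ψ ∈ X → IsAnd c φ ψ → c ∈ X)
    × (∀ c i φ → IsNat i → φ ∈ X → IsEx c i φ → c ∈ X)

  -- Not vacuous: in ZF the set V_ω is formula-closed.
  IsFormula : V → Set ℓ
  IsFormula φ = ∀ X → IsFormulaClosed X → φ ∈ X

  -- Assignments are total functions s : ω → M.
  IsAssignment : V → V → Set ℓ
  IsAssignment M s = ∃[ w ] (IsOmega w × IsFunction s w M)

  -- t = s[i ↦ x]
  IsUpdate : V → V → V → V → V → Set ℓ
  IsUpdate M t s i x =
      IsAssignment M t
    × t ∋⟨ i , x ⟩
    × (∀ k y → IsNat k → k ≢ i → t ∋⟨ k , y ⟩ ⇔ s ∋⟨ k , y ⟩)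

  -- S is a satisfaction relation for ⟨M,∈⟩: Tarski's clauses, where
  -- S ∋⟨ φ , s ⟩ reads ⟨M,∈⟩ ⊨ φ[s].
  IsSatisfaction : V → V → Set ℓ
  IsSatisfaction M S =
      (∀ c i j s → IsNat i → IsNat j → IsMem c i j → IsAssignment M s →
         S ∋⟨ c , s ⟩ ⇔ (∃[ x ] ∃[ y ] (s ∋⟨ i , x ⟩ × s ∋⟨ j , y ⟩ × x ∈ y)))
    × (∀ c i j s → IsNat i → IsNat j → IsEq c i j → IsAssignment M s →
         S ∋⟨ c , s ⟩ ⇔ (∃[ x ] ∃[ y ] (s ∋⟨ i , x ⟩ × s ∋⟨ j , y ⟩ × x ≡ y)))
    × (∀ c φ s → IsFormula φ → IsNot c φ → IsAssignment M s →
         S ∋⟨ c , s ⟩ ⇔ (¬ (S ∋⟨ φ , s ⟩)))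
    × (∀ c φ ψ s → IsFormula φ → IsFormula ψ → IsAnd c φ ψ → IsAssignment M s →
         S ∋⟨ c , s ⟩ ⇔ (S ∋⟨ φ , s ⟩ × S ∋⟨ ψ , s ⟩))
    × (∀ c i φ s → IsNat i → IsFormula φ → IsEx c i φ → IsAssignment M s →
         S ∋⟨ c , s ⟩ ⇔
         (∃[ x ] ∃[ t ] (x ∈ M × IsUpdate M t s i x × S ∋⟨ φ , t ⟩)))

  -- ⟨M,∈⟩ ⊨ φ[s]
  Satisfies : V → V → V → Set ℓ
  Satisfies M φ s = ∃[ S ] (IsSatisfaction M S × S ∋⟨ φ , s ⟩)

  -- j : ⟨M,∈⟩ → ⟨N,∈⟩ is elementary; t plays the role of j ∘ s.
  IsElementary : V → V → V → Set ℓ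
  IsElementary j M N =
      IsFunction j M N
    × (∀ φ s t → IsFormula φ → IsAssignment M s → IsAssignment N t →
         (∀ k x y → s ∋⟨ k , x ⟩ → j ∋⟨ x , y ⟩ → t ∋⟨ k , y ⟩) →
         Satisfies M φ s ⇔ Satisfies N φ t)

  Moves : V → V → Set ℓ
  Moves j x = ∃[ y ] (j ∋⟨ x , y ⟩ × x ≢ y)

  IsNontrivial : V → Set ℓ
  IsNontrivial j = ∃[ α ] (IsOrdinal α × Moves j α)

  -- κ = crit(j)
  IsCrit : V → V → Set ℓ
  IsCrit κ j = IsOrdinal κ × Moves j κ × (∀ α → α ∈ κ → ¬ Moves j α)

  IsBerkeley : V → Set ℓ
  IsBerkeley δ =
      IsCardinal δ
    × (∀ M → IsTransitive M → δ ∈ M → ∀ η → η ∈ δ →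
         ∃[ j ] ( IsElementary j M M × IsNontrivial j
                × (∃[ κ ] (IsCrit κ j × η ∈ κ × κ ∈ δ))))

  World : V → V → Set ℓ
  World δ M = IsTransitive M × δ ∈ M

  Accesses : V → V → Set ℓ
  Accesses M N =
      M ⊆ N
    × (∀ j → IsElementary j N N → ∃[ r ] (IsRestriction r j M × IsElementary r M M))

  -- Structures for the language {∈} whose domain is a (possibly proper) class.
  record Structure : Set (lsuc ℓ) where
    field
      Domain : V → Set ℓ
      Rel    : V → V → Set ℓ

  ⟨V,∈⟩ : Structure
  ⟨V,∈⟩ = record { Domain = λ _ → ⊤ ; Rel = _∈_ }

  ⟨_,∈⟩ : V → Structure
  ⟨ M ,∈⟩ = record { Domain = _∈ M ; Rel = λ x y → x ∈ M × y ∈ M × x ∈ y }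

  IsSubstructure : Structure → Structure → Set ℓ
  IsSubstructure 𝔸 𝔹 =
      (∀ x → A.Domain x → B.Domain x)
    × (∀ x y → A.Domain x → A.Domain y → A.Rel x y ⇔ B.Rel x y)
    where
    module A = Structure 𝔸
    module B = Structure 𝔹

  ProvidesPotentialistAccount : (V → Set ℓ) → (V → V → Set ℓ) → Set ℓ
  ProvidesPotentialistAccount 𝓜 𝓡 =
      (∀ M → 𝓜 M → IsSubstructure ⟨ M ,∈⟩ ⟨V,∈⟩)
    × (∀ M → 𝓜 M → ∀ a → ∃[ N ] (𝓜 N × 𝓡 M N × a ∈ N))

{-# OPTIONS --safe #-}

-- Given M and a, take a transitive U including M with a ∈ U, and let N = U ∪ {U} ∪ {M ∪ {U}}.
-- Then M is definable without parameters over ⟨N,∈⟩, namely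
--   x ∈ M  iff  ∃ y (no element of N contains y, x ∈ y, and x ∈ u for some u ∈ y),
-- so every formula about ⟨M,∈⟩ relativizes to a formula about ⟨N,∈⟩ with the same
-- parameters, and an elementary j : N → N restricts to an elementary map M → M.
-- Since V may have nonstandard natural numbers, satisfaction and relativization are handled
-- by induction inside V over the coded formulas.
module Submission where

open import Data.Empty using (⊥-elim)
open import Data.Fin.Base using (Fin; suc; toℕ; _↑ʳ_)
open import Data.Fin.Patterns
open import Data.Fin.Properties using (toℕ-injective)
open import Data.Nat.Base using (ℕ; zero; suc)
open import Data.Product.Base using (∃-syntax; _×_; _,_; proj₁; proj₂)
open import Data.Product.Function.NonDependent.Propositional using (_×-⇔_)
open import Data.Sum.Base as Sum using (_⊎_; inj₁; inj₂)
open import Data.Unit.Polymorphic.Base using (tt)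
open import Data.Vec.Base using (Vec; []; _∷_; lookup)
open import Function.Base using (id)
open import Function.Bundles using (_⇔_; mk⇔; module Equivalence)
open import Function.Construct.Identity using (⇔-id)
open import Function.Construct.Symmetry using (⇔-sym)
open import Function.Construct.Composition using (_⇔-∘_)
open import Function.Related.TypeIsomorphisms using (¬-cong-⇔)
open import Level using (Level)
open import Relation.Binary.PropositionalEquality using (_≡_; _≢_; refl; sym; cong; subst)
open import Relation.Nullary using (¬_; Dec; yes; no)

open import Defs
  renaming ( ¬′_ to infixr 9 ¬′_; ∀′_ to infixr 9 ∀′_; ∃′_ to infixr 9 ∃′_
           ; _∈′_ to infix 8 _∈′_; _≡′_ to infix 8 _≡′_; _∧′_ to infixr 7 _∧′_
           ; _∨′_ to infixr 6 _∨′_; _⇒′_ to infixr 5 _⇒′_; _⇔′_ to infix 4 _⇔′_ )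

open Equivalence using (to; from)

-- Each primed formula is interpreted, by computation, as the predicate of the same name in Defs
-- or below; this is what makes Separation, Replacement and induction applicable.

-- The definition of `M` may use no parameter, since an elementary `j : N → N` can move `M` even
-- when `M ∈ N`; what `j` respects is membership in a class defined without parameters. The marker
-- for `M` must therefore be recognizable from ∈ alone. The set `M ∪ {U}` is: it contains `U`, so
-- Foundation keeps it out of every element of `N`, while all other elements of `N` lie in `U` or in
-- the marker. The same `U` is the only element of the marker outside `M`, and it is told apart
-- because elements of `M` lie in `U`, whereas `U` lies in no element of the marker.
--
-- A second obstacle is that Separation and Replacement, and hence every induction inside `V`, apply
-- only to a `Formula`.

upair′ pair′ at′ : ∀ {n} → Fin n → Fin n → Fin n → Formula n
upair′ p x y = ∀′ (0F ∈′ suc p ⇔′ 0F ≡′ suc x ∨′ 0F ≡′ suc y)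
pair′ p x y  = ∃′ ∃′ (upair′ 1F (2 ↑ʳ x) (2 ↑ʳ x) ∧′ upair′ 0F (2 ↑ʳ x) (2 ↑ʳ y) ∧′
                      upair′ (2 ↑ʳ p) 1F 0F)
at′ f x y    = ∃′ (pair′ 0F (suc x) (suc y) ∧′ 0F ∈′ suc f)

empty′ inductive′ nat′ omega′ : ∀ {n} → Fin n → Formula n
succ′ : ∀ {n} → Fin n → Fin n → Formula n
empty′ x     = ∀′ ¬′ (0F ∈′ suc x)
succ′ y x    = ∀′ (0F ∈′ suc y ⇔′ 0F ∈′ suc x ∨′ 0F ≡′ suc x)
inductive′ X = ∃′ (empty′ 0F ∧′ 0F ∈′ suc X) ∧′
               ∀′ (0F ∈′ suc X ⇒′ ∃′ (succ′ 0F 1F ∧′ 0F ∈′ (2 ↑ʳ X)))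
nat′ x       = ∀′ (inductive′ 0F ⇒′ suc x ∈′ 0F)
omega′ w     = ∀′ (0F ∈′ suc w ⇔′ nat′ 0F)

function′ : ∀ {n} → Fin n → Fin n → Fin n → Formula n
function′ f A B =
  ∀′ (0F ∈′ suc f ⇒′ ∃′ ∃′ (1F ∈′ (3 ↑ʳ A) ∧′ 0F ∈′ (3 ↑ʳ B) ∧′ pair′ 2F 1F 0F)) ∧′
  ∀′ (0F ∈′ suc A ⇒′ ∃′ at′ (2 ↑ʳ f) 1F 0F) ∧′
  ∀′ ∀′ ∀′ (at′ (3 ↑ʳ f) 2F 1F ⇒′ at′ (3 ↑ʳ f) 2F 0F ⇒′ 1F ≡′ 0F)

assignment′ : ∀ {n} → Fin n → Fin n → Formula n
assignment′ M s = ∃′ (omega′ 0F ∧′ function′ (suc s) 0F (suc M))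

update′ : ∀ {n} → Fin n → Fin n → Fin n → Fin n → Fin n → Formula n
update′ M t s i x =
  assignment′ M t ∧′ at′ t i x ∧′
  ∀′ ∀′ (nat′ 1F ⇒′ ¬′ (1F ≡′ (2 ↑ʳ i)) ⇒′ (at′ (2 ↑ʳ t) 1F 0F ⇔′ at′ (2 ↑ʳ s) 1F 0F))

numeral′ : ∀ {n} → ℕ → Fin n → Formula n
numeral′ zero    x = empty′ x
numeral′ (suc k) x = ∃′ (numeral′ k 0F ∧′ succ′ (suc x) 0F)

tagged′ : ∀ {n} → ℕ → Fin n → Fin n → Fin n → Formula n
tagged′ k c a b =
  ∃′ ∃′ (numeral′ k 1F ∧′ pair′ 0F (2 ↑ʳ a) (2 ↑ʳ b) ∧′ pair′ (2 ↑ʳ c) 1F 0F)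

formulaClosed′ formula′ : ∀ {n} → Fin n → Formula n
formulaClosed′ X =
  ∀′ ∀′ ∀′ (nat′ 1F ⇒′ nat′ 0F ⇒′ tagged′ 0 2F 1F 0F ⇒′ 2F ∈′ (3 ↑ʳ X)) ∧′
  ∀′ ∀′ ∀′ (nat′ 1F ⇒′ nat′ 0F ⇒′ tagged′ 1 2F 1F 0F ⇒′ 2F ∈′ (3 ↑ʳ X)) ∧′
  ∀′ ∀′ (0F ∈′ (2 ↑ʳ X) ⇒′ tagged′ 2 1F 0F 0F ⇒′ 1F ∈′ (2 ↑ʳ X)) ∧′
  ∀′ ∀′ ∀′ (1F ∈′ (3 ↑ʳ X) ⇒′ 0F ∈′ (3 ↑ʳ X) ⇒′ tagged′ 3 2F 1F 0F ⇒′ 2F ∈′ (3 ↑ʳ X)) ∧′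
  ∀′ ∀′ ∀′ (nat′ 1F ⇒′ 0F ∈′ (3 ↑ʳ X) ⇒′ tagged′ 4 2F 1F 0F ⇒′ 2F ∈′ (3 ↑ʳ X))
formula′ φ = ∀′ (formulaClosed′ 0F ⇒′ suc φ ∈′ 0F)

-- The immediate subformula relation, tag by tag. Atomic codes have no subformula, and `Formula` has
-- no constant for falsity, hence the contradiction `¬ (d ≡ d)`.
child′ : ∀ {n} → Fin 5 → Fin n → Fin n → Fin n → Formula n
child′ 0F a b d = ¬′ (d ≡′ d)
child′ 1F a b d = ¬′ (d ≡′ d)
child′ 2F a b d = d ≡′ a
child′ 3F a b d = d ≡′ a ∨′ d ≡′ b
child′ 4F a b d = d ≡′ b

clause′ : ∀ {n} → Fin 5 → Fin n → Fin n → Fin n → Fin n → Fin n → Formula n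
clause′ 0F M S a b s = ∃′ ∃′ (at′ (2 ↑ʳ s) (2 ↑ʳ a) 1F ∧′ at′ (2 ↑ʳ s) (2 ↑ʳ b) 0F ∧′ 1F ∈′ 0F)
clause′ 1F M S a b s = ∃′ ∃′ (at′ (2 ↑ʳ s) (2 ↑ʳ a) 1F ∧′ at′ (2 ↑ʳ s) (2 ↑ʳ b) 0F ∧′ 1F ≡′ 0F)
clause′ 2F M S a b s = ¬′ at′ S a s
clause′ 3F M S a b s = at′ S a s ∧′ at′ S b s
clause′ 4F M S a b s = ∃′ ∃′ (1F ∈′ (2 ↑ʳ M) ∧′ update′ (2 ↑ʳ M) 0F (2 ↑ʳ s) (2 ↑ʳ a) 1F ∧′
                              at′ (2 ↑ʳ S) (2 ↑ʳ b) 0F)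

-- In q k, the variables 1 and 0 stand for the two components of a code with tag k.
byTag′ : ∀ {n} → (Fin 5 → Formula (suc (suc n))) → Fin n → Formula n
byTag′ q c = tag 0F ∧′ tag 1F ∧′ tag 2F ∧′ tag 3F ∧′ tag 4F
  where
  tag : Fin 5 → Formula _
  tag k = ∀′ ∀′ (tagged′ (toℕ k) (2 ↑ʳ c) 1F 0F ⇒′ q k)

children′ : ∀ {n} → Fin n → Fin n → Formula n
children′ c D = byTag′ (λ k → ∀′ (child′ k 2F 1F 0F ⇒′ 0F ∈′ (3 ↑ʳ D))) c

eval′ : ∀ {n} → Fin n → Fin n → Fin n → Fin n → Formula n
eval′ M S c s = byTag′ (λ k → clause′ k (2 ↑ʳ M) (2 ↑ʳ S) 1F 0F (2 ↑ʳ s)) c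

attempt′ : ∀ {n} → Fin n → Fin n → Fin n → Formula n
attempt′ M D S =
  ∀′ (0F ∈′ suc D ⇒′ formula′ 0F ∧′ children′ 0F (suc D)) ∧′
  ∀′ ∀′ (1F ∈′ (2 ↑ʳ D) ⇒′ assignment′ (2 ↑ʳ M) 0F ⇒′
         (at′ (2 ↑ʳ S) 1F 0F ⇔′ eval′ (2 ↑ʳ M) (2 ↑ʳ S) 1F 0F))

module ZF {ℓ : Level} (𝓥 : Universe ℓ) (zf : SetTheory.IsZF 𝓥) where

  open SetTheory 𝓥
  open IsZF zf

  _≟_ : ∀ x y → Dec (x ≡ y)
  x ≟ y = excludedMiddle (0F ≡′ 1F) (x ∷ y ∷ [])

  ext : ∀ {x y} → x ⊆ y → y ⊆ x → x ≡ y
  ext x⊆y y⊆x = extensionality _ _ (λ z → mk⇔ (x⊆y z) (y⊆x z))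

  -- Unordered and ordered pairs

  upair-unique : ∀ {p q x y} → IsUPair p x y → IsUPair q x y → p ≡ q
  upair-unique P Q = extensionality _ _ (λ z → ⇔-sym (Q z) ⇔-∘ P z)

  pair-unique : ∀ {p q x y} → IsPair p x y → IsPair q x y → p ≡ q
  pair-unique (a , b , A , B , P) (a′ , b′ , A′ , B′ , Q)
    rewrite upair-unique A A′ | upair-unique B B′ = upair-unique P Q

  upair-left : ∀ {p x y} → IsUPair p x y → x ∈ p
  upair-left P = from (P _) (inj₁ refl)

  upair-right : ∀ {p x y} → IsUPair p x y → y ∈ p
  upair-right P = from (P _) (inj₂ refl)

  upair-⊆ : ∀ {p x y z} → IsUPair p x y → x ∈ z → y ∈ z → p ⊆ z
  upair-⊆ P x∈z y∈z u u∈p with to (P u) u∈p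
  ... | inj₁ refl = x∈z
  ... | inj₂ refl = y∈z

  pair-exists : ∀ x y → ∃[ p ] IsPair p x y
  pair-exists x y with pairing x x | pairing x y
  ... | a , A | b , B with pairing a b
  ... | p , P = p , a , b , A , B , P

  private
    singleton-elim : ∀ {a x y} → IsUPair a x x → y ∈ a → y ≡ x
    singleton-elim A y∈a with to (A _) y∈a
    ... | inj₁ e = e
    ... | inj₂ e = e

    pair-fst : ∀ {p x y x′ y′} → IsPair p x y → IsPair p x′ y′ → x ≡ x′
    pair-fst (a , b , A , B , P) (a′ , b′ , A′ , B′ , Q) with to (Q a) (upair-left P)
    ... | inj₁ refl = singleton-elim A′ (upair-left A)
    ... | inj₂ refl = sym (singleton-elim A (upair-left B′))

    -- From `y ∈ {x , y′}` alone the degenerate case `y ≡ x` cannot be excluded; `pair-injective`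
    -- settles it by applying this lemma in both directions.
    pair-snd : ∀ {p x y y′} → IsPair p x y → IsPair p x y′ → y ≡ x ⊎ y ≡ y′
    pair-snd (a , b , A , B , P) (a′ , b′ , A′ , B′ , Q) with to (Q b) (upair-right P)
    ... | inj₁ refl = inj₁ (singleton-elim A′ (upair-right B))
    ... | inj₂ refl = to (B′ _) (upair-right B)

  pair-injective : ∀ {p x y x′ y′} → IsPair p x y → IsPair p x′ y′ → x ≡ x′ × y ≡ y′
  pair-injective P Q with pair-fst P Q
  ... | refl with pair-snd P Q | pair-snd Q P
  ...   | inj₂ e    | _         = refl , e
  ...   | _         | inj₂ e    = refl , sym e
  ...   | inj₁ refl | inj₁ refl = refl , refl

  -- Foundation

  no-2-cycle : ∀ {x y} → x ∈ y → ¬ (y ∈ x)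
  no-2-cycle {x} {y} x∈y y∈x with pairing x y
  ... | p , P with foundation p (x , upair-left P)
  ... | z , z∈p , minimal with to (P z) z∈p
  ... | inj₁ refl = minimal y y∈x (upair-right P)
  ... | inj₂ refl = minimal x x∈y (upair-left P)

  no-1-cycle : ∀ {x} → ¬ (x ∈ x)
  no-1-cycle x∈x = no-2-cycle x∈x x∈x

  ∈⇒≢ : ∀ {x y} → x ∈ y → x ≢ y
  ∈⇒≢ x∈y refl = no-1-cycle x∈y

  -- Unions, successors and natural numbers

  binary-union : ∀ x y → ∃[ u ] (∀ z → z ∈ u ⇔ (z ∈ x ⊎ z ∈ y))
  binary-union x y with pairing x y
  ... | p , P with union p
  ... | u , U = u , λ z → mk⇔ (f z) (g z)
    where
    f : ∀ z → z ∈ u → z ∈ x ⊎ z ∈ y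
    f z z∈u with to (U z) z∈u
    ... | v , v∈p , z∈v with to (P v) v∈p
    ...   | inj₁ refl = inj₁ z∈v
    ...   | inj₂ refl = inj₂ z∈v
    g : ∀ z → z ∈ x ⊎ z ∈ y → z ∈ u
    g z (inj₁ z∈x) = from (U z) (x , upair-left P , z∈x)
    g z (inj₂ z∈y) = from (U z) (y , upair-right P , z∈y)

  adjoin : ∀ x y → ∃[ u ] (∀ z → z ∈ u ⇔ (z ∈ x ⊎ z ≡ y))
  adjoin x y with pairing y y
  ... | s , S with binary-union x s
  ... | u , U = u , λ z → mk⇔ (λ z∈u → f z (to (U z) z∈u)) (g z)
    where
    f : ∀ z → z ∈ x ⊎ z ∈ s → z ∈ x ⊎ z ≡ y
    f z (inj₁ z∈x) = inj₁ z∈x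
    f z (inj₂ z∈s) = inj₂ (singleton-elim S z∈s)
    g : ∀ z → z ∈ x ⊎ z ≡ y → z ∈ u
    g z (inj₁ z∈x)  = from (U z) (inj₁ z∈x)
    g z (inj₂ refl) = from (U z) (inj₂ (upair-left S))

  succ-exists : ∀ x → ∃[ y ] IsSucc y x
  succ-exists x = adjoin x x

  succ-∋ : ∀ {x y} → IsSucc y x → x ∈ y
  succ-∋ S = from (S _) (inj₂ refl)

  succ-unique : ∀ {x y y′} → IsSucc y x → IsSucc y′ x → y ≡ y′
  succ-unique S S′ = extensionality _ _ (λ z → ⇔-sym (S′ z) ⇔-∘ S z)

  succ-injective : ∀ {x x′ y} → IsSucc y x → IsSucc y x′ → x ≡ x′
  succ-injective S S′ with to (S′ _) (succ-∋ S) | to (S _) (succ-∋ S′)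
  ... | inj₂ e    | _          = e
  ... | inj₁ _    | inj₂ e     = sym e
  ... | inj₁ x∈x′ | inj₁ x′∈x = ⊥-elim (no-2-cycle x∈x′ x′∈x)

  empty-unique : ∀ {x y} → IsEmpty x → IsEmpty y → x ≡ y
  empty-unique E E′ = ext (λ z z∈x → ⊥-elim (E z z∈x)) (λ z z∈y → ⊥-elim (E′ z z∈y))

  nat-zero : ∀ {e} → IsEmpty e → IsNat e
  nat-zero E X ((e , E′ , e∈X) , _) rewrite empty-unique E E′ = e∈X

  nat-suc : ∀ {n m} → IsSucc m n → IsNat n → IsNat m
  nat-suc S nat X ind@(_ , step) with step _ (nat X ind)
  ... | m , S′ , m∈X rewrite succ-unique S S′ = m∈X

  omega-exists : ∃[ w ] IsOmega w
  omega-exists with infinity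
  ... | X , ind with separation (nat′ 0F) [] X
  ... | w , W = w , λ n → mk⇔ (λ n∈w → proj₂ (to (W n) n∈w)) (λ nat → from (W n) (nat X ind , nat))

  empty-exists : ∃[ e ] IsEmpty e
  empty-exists with infinity
  ... | _ , (e , E , _) , _ = e , E

  -- Naturals are the members of all inductive sets, so Separation on ω carves out an inductive set
  -- that must contain each of them. Nonstandard naturals of `V` are thereby included.
  nat-induction : ∀ {n} (φ : Formula (suc n)) (ρ : Vec V n) →
    (∀ e → IsEmpty e → e ∷ ρ ⊨ φ) →
    (∀ x y → IsSucc y x → x ∷ ρ ⊨ φ → y ∷ ρ ⊨ φ) →
    ∀ x → IsNat x → x ∷ ρ ⊨ φ
  nat-induction φ ρ base step x nat with omega-exists
  ... | w , W with separation φ ρ w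
  ... | X , D = proj₂ (to (D x) (nat X (zero∈X , suc∈X)))
    where
    zero∈X : ∃[ e ] (IsEmpty e × e ∈ X)
    zero∈X with empty-exists
    ... | e , E = e , E , from (D e) (from (W e) (nat-zero E) , base e E)
    suc∈X : ∀ x → x ∈ X → ∃[ y ] (IsSucc y x × y ∈ X)
    suc∈X x x∈X with succ-exists x | to (D x) x∈X
    ... | y , S | x∈w , p =
      y , S , from (D y) (from (W y) (nat-suc S (to (W x) x∈w)) , step x y S p)

  numeral-nat : ∀ k {x} → IsNumeral k x → IsNat x
  numeral-nat zero    E           = nat-zero E
  numeral-nat (suc k) (y , N , S) = nat-suc S (numeral-nat k N)

  numeral-exists : ∀ k → ∃[ x ] IsNumeral k x
  numeral-exists zero = empty-exists
  numeral-exists (suc k) with numeral-exists k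
  ... | y , N with succ-exists y
  ... | x , S = x , y , N , S

  numeral-injective : ∀ k l {x} → IsNumeral k x → IsNumeral l x → k ≡ l
  numeral-injective zero    zero    _ _ = refl
  numeral-injective zero    (suc l) E (y , _ , S) = ⊥-elim (E y (succ-∋ S))
  numeral-injective (suc k) zero    (y , _ , S) E = ⊥-elim (E y (succ-∋ S))
  numeral-injective (suc k) (suc l) (y , N , S) (y′ , N′ , S′)
    rewrite succ-injective S S′ = cong suc (numeral-injective k l N N′)

  tagged-injective : ∀ (k l : Fin 5) {c a b a′ b′} →
    IsTagged (toℕ k) c a b → IsTagged (toℕ l) c a′ b′ → k ≡ l × a ≡ a′ × b ≡ b′
  tagged-injective k l (t , p , N , P , C) (t′ , p′ , N′ , P′ , C′) with pair-injective C C′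
  ... | refl , refl =
    toℕ-injective (numeral-injective (toℕ k) (toℕ l) N N′) , pair-injective P P′

  tagged-exists : ∀ k a b → ∃[ c ] IsTagged k c a b
  tagged-exists k a b with numeral-exists k | pair-exists a b
  ... | t , N | p , P with pair-exists t p
  ... | c , C = c , t , p , N , P , C

  -- Sets closed under pairing

  -- Each disjunct serves the union of the iterates: `A` is the seed, `X` makes the iteration
  -- increasing, elements of elements give transitivity, and subsets give closure under unordered
  -- pairs.
  Step : V → V → V → Set ℓ
  Step A X Y = ∀ z → z ∈ Y ⇔ (z ≡ A ⊎ (z ∈ X ⊎ ((∃[ y ] (y ∈ X × z ∈ y)) ⊎ z ⊆ X)))

  step-exists : ∀ A X → ∃[ Y ] Step A X Y
  step-exists A X with union X | powerset X
  ... | u , U | p , P with binary-union u p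
  ... | v , W with binary-union X v
  ... | x , X′ with adjoin x A
  ... | Y , Y′ = Y , λ z → mk⇔ (λ h → f₁ z (to (Y′ z) h)) (g z)
    where
    R : V → Set ℓ
    R z = (∃[ y ] (y ∈ X × z ∈ y)) ⊎ z ⊆ X
    f₃ : ∀ z → z ∈ u ⊎ z ∈ p → R z
    f₃ z (inj₁ h) = inj₁ (to (U z) h)
    f₃ z (inj₂ h) = inj₂ (to (P z) h)
    f₂ : ∀ z → z ∈ X ⊎ z ∈ v → z ∈ X ⊎ R z
    f₂ z (inj₁ h) = inj₁ h
    f₂ z (inj₂ h) = inj₂ (f₃ z (to (W z) h))
    f₁ : ∀ z → z ∈ x ⊎ z ≡ A → z ≡ A ⊎ (z ∈ X ⊎ R z)
    f₁ z (inj₁ h) = inj₂ (f₂ z (to (X′ z) h))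
    f₁ z (inj₂ h) = inj₁ h
    g : ∀ z → z ≡ A ⊎ (z ∈ X ⊎ R z) → z ∈ Y
    g z (inj₁ h)               = from (Y′ z) (inj₂ h)
    g z (inj₂ (inj₁ h))        = from (Y′ z) (inj₁ (from (X′ z) (inj₁ h)))
    g z (inj₂ (inj₂ (inj₁ h))) =
      from (Y′ z) (inj₁ (from (X′ z) (inj₂ (from (W z) (inj₁ (from (U z) h))))))
    g z (inj₂ (inj₂ (inj₂ h))) =
      from (Y′ z) (inj₁ (from (X′ z) (inj₂ (from (W z) (inj₂ (from (P z) h))))))

  step-unique : ∀ {A X Y Y′} → Step A X Y → Step A X Y′ → Y ≡ Y′
  step-unique S S′ = extensionality _ _ (λ z → ⇔-sym (S′ z) ⇔-∘ S z)

  step-monotone : ∀ {A X X′ Y Y′} → X ⊆ X′ → Step A X Y → Step A X′ Y′ → Y ⊆ Y′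
  step-monotone {A} {X} {X′} {Y} {Y′} X⊆X′ S S′ z z∈Y = from (S′ z) (f (to (S z) z∈Y))
    where
    f : z ≡ A ⊎ (z ∈ X ⊎ ((∃[ y ] (y ∈ X × z ∈ y)) ⊎ z ⊆ X)) →
        z ≡ A ⊎ (z ∈ X′ ⊎ ((∃[ y ] (y ∈ X′ × z ∈ y)) ⊎ z ⊆ X′))
    f (inj₁ h)                            = inj₁ h
    f (inj₂ (inj₁ h))                     = inj₂ (inj₁ (X⊆X′ z h))
    f (inj₂ (inj₂ (inj₁ (y , y∈X , h)))) = inj₂ (inj₂ (inj₁ (y , X⊆X′ y y∈X , h)))
    f (inj₂ (inj₂ (inj₂ h)))              = inj₂ (inj₂ (inj₂ (λ u u∈z → X⊆X′ u (h u u∈z))))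

  -- X₀ = ∅ and Xₙ₊₁ = {A} ∪ Xₙ ∪ ⋃Xₙ ∪ P(Xₙ); a history is a set of pairs ⟨n , Xₙ⟩
  -- containing with each pair the previous one.
  History : V → V → Set ℓ
  History A K = ∀ n Y → K ∋⟨ n , Y ⟩ →
    (IsEmpty n × IsEmpty Y) ⊎
    (∃[ m ] ∃[ X ] (IsSucc n m × (K ∋⟨ m , X ⟩ × Step A X Y)))

  Stage : V → V → V → Set ℓ
  Stage A n Y = ∃[ K ] (History A K × K ∋⟨ n , Y ⟩)

  step′ : ∀ {n} → Fin n → Fin n → Fin n → Formula n
  step′ A X Y = ∀′ (0F ∈′ suc Y ⇔′ 0F ≡′ suc A ∨′ 0F ∈′ suc X ∨′
    ∃′ (0F ∈′ (2 ↑ʳ X) ∧′ 1F ∈′ 0F) ∨′ ∀′ (0F ∈′ 1F ⇒′ 0F ∈′ (2 ↑ʳ X)))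

  stage′ : ∀ {n} → Fin n → Fin n → Fin n → Formula n
  stage′ A n Y = ∃′ (∀′ ∀′ (at′ 2F 1F 0F ⇒′
    (empty′ 1F ∧′ empty′ 0F) ∨′
    ∃′ ∃′ (succ′ 3F 1F ∧′ at′ 4F 1F 0F ∧′ step′ (5 ↑ʳ A) 0F 2F)) ∧′
    at′ 0F (suc n) (suc Y))

  stage-zero : ∀ {A e Y} → IsEmpty e → Stage A e Y → IsEmpty Y
  stage-zero E (K , H , at) with H _ _ at
  ... | inj₁ (_ , E′)              = E′
  ... | inj₂ (m , _ , S , _) = ⊥-elim (E m (succ-∋ S))

  stage-pred : ∀ {A n m Y} → IsSucc m n → Stage A m Y → ∃[ X ] (Stage A n X × Step A X Y)
  stage-pred S (K , H , at) with H _ _ at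
  ... | inj₁ (E , _) = ⊥-elim (E _ (succ-∋ S))
  ... | inj₂ (n′ , X , S′ , at′ , st) rewrite succ-injective S S′ = X , (K , H , at′) , st

  adjoin-pair : ∀ K x y → ∃[ L ] (L ∋⟨ x , y ⟩ × K ⊆ L ×
    (∀ u v → L ∋⟨ u , v ⟩ → K ∋⟨ u , v ⟩ ⊎ (u ≡ x × v ≡ y)))
  adjoin-pair K x y with pair-exists x y
  ... | p , P with adjoin K p
  ... | L , D = L , (p , P , from (D p) (inj₂ refl)) , (λ z z∈K → from (D z) (inj₁ z∈K)) , f
    where
    f : ∀ u v → L ∋⟨ u , v ⟩ → K ∋⟨ u , v ⟩ ⊎ (u ≡ x × v ≡ y)
    f u v (q , Q , q∈L) with to (D q) q∈L
    ... | inj₁ q∈K  = inj₁ (q , Q , q∈K)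
    ... | inj₂ refl = inj₂ (pair-injective Q P)

  ∋-mono : ∀ {K L x y} → K ⊆ L → K ∋⟨ x , y ⟩ → L ∋⟨ x , y ⟩
  ∋-mono K⊆L (p , P , p∈K) = p , P , K⊆L p p∈K

  history-adjoin : ∀ {A K n Y} → History A K →
    (IsEmpty n × IsEmpty Y) ⊎
    (∃[ m ] ∃[ X ] (IsSucc n m × (K ∋⟨ m , X ⟩ × Step A X Y))) → Stage A n Y
  history-adjoin {A} {K} {n} {Y} H new with adjoin-pair K n Y
  ... | L , at , K⊆L , inv = L , H′ , at
    where
    weaken : ∀ {n Y} → (IsEmpty n × IsEmpty Y) ⊎
      (∃[ m ] ∃[ X ] (IsSucc n m × (K ∋⟨ m , X ⟩ × Step A X Y))) →
      (IsEmpty n × IsEmpty Y) ⊎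
      (∃[ m ] ∃[ X ] (IsSucc n m × (L ∋⟨ m , X ⟩ × Step A X Y)))
    weaken (inj₁ h)                     = inj₁ h
    weaken (inj₂ (m , X , S , at , st)) = inj₂ (m , X , S , ∋-mono K⊆L at , st)
    H′ : History A L
    H′ u v at with inv u v at
    ... | inj₁ at′           = weaken (H u v at′)
    ... | inj₂ (refl , refl) = weaken new

  stage-empty : ∀ A {e} → IsEmpty e → Stage A e e
  stage-empty A {e} E =
    history-adjoin {K = e} (λ { _ _ (p , _ , p∈e) → ⊥-elim (E p p∈e) }) (inj₁ (E , E))

  stage-step : ∀ {A n m X Y} → IsSucc m n → Stage A n X → Step A X Y → Stage A m Y
  stage-step S (K , H , at) st = history-adjoin H (inj₂ (_ , _ , S , at , st))

  stage-total : ∀ A n → IsNat n → ∃[ Y ] Stage A n Y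
  stage-total A = nat-induction (∃′ (stage′ 2F 1F 0F)) (A ∷ [])
    (λ e E → e , stage-empty A E)
    (λ { n m S (X , st) → let (Y , step) = step-exists A X in Y , stage-step S st step })

  stage-unique : ∀ A n → IsNat n → ∀ Y Y′ → Stage A n Y → Stage A n Y′ → Y ≡ Y′
  stage-unique A = nat-induction
    (∀′ ∀′ (stage′ 3F 2F 1F ⇒′ stage′ 3F 2F 0F ⇒′ 1F ≡′ 0F)) (A ∷ [])
    (λ e E Y Y′ st st′ → empty-unique (stage-zero E st) (stage-zero E st′))
    suc-case
    where
    suc-case : ∀ n m → IsSucc m n → (∀ X X′ → Stage A n X → Stage A n X′ → X ≡ X′) →
      ∀ Y Y′ → Stage A m Y → Stage A m Y′ → Y ≡ Y′
    suc-case n m S IH Y Y′ st st′ with stage-pred S st | stage-pred S st′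
    ... | X , stX , step | X′ , stX′ , step′ rewrite IH X X′ stX stX′ = step-unique step step′

  stages : ∀ A → ∃[ Z ] (∀ Y → Y ∈ Z ⇔ (∃[ n ] (IsNat n × Stage A n Y)))
  stages A with omega-exists
  ... | w , W with replacement (stage′ 2F 0F 1F) (A ∷ []) w
                    (λ n Y Y′ n∈w → stage-unique A n (to (W n) n∈w) Y Y′)
  ... | Z , D = Z , λ Y → mk⇔
    (λ Y∈Z → let (n , n∈w , st) = to (D Y) Y∈Z in n , to (W n) n∈w , st)
    (λ { (n , nat , st) → from (D Y) (n , from (W n) nat , st) })

  -- A substitute for a limit level of the cumulative hierarchy that avoids ranks. The hull of ω
  -- will bound all codes of formulas, and the hull of `{M , a}` will be the set `U` of the
  -- construction.
  record Hull (A U : V) : Set ℓ where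
    field
      base       : A ∈ U
      transitive : IsTransitive U
      upaired    : ∀ {p x y} → IsUPair p x y → x ∈ U → y ∈ U → p ∈ U

    paired : ∀ {p x y} → IsPair p x y → x ∈ U → y ∈ U → p ∈ U
    paired (a , b , P , Q , R) x∈U y∈U = upaired R (upaired P x∈U x∈U) (upaired Q x∈U y∈U)

  hull : ∀ A → ∃[ U ] Hull A U
  hull A with stages A
  ... | Z , D with union Z
  ... | U , E = U , record { base = base ; transitive = transitive ; upaired = upaired }
    where
    closed : ∀ {X Y} → X ∈ Z → Step A X Y → Y ∈ Z
    closed X∈Z st =
      let (n , nat , stage) = to (D _) X∈Z
          (m , S)           = succ-exists n
      in from (D _) (m , nat-suc S nat , stage-step S stage st)

    -- Comparing the indices of two stages is avoided by induction on the index of `X` alone: a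
    -- common bound of the predecessor of `X` and of `Y`, advanced by one step, bounds `X` by
    -- monotonicity and still includes `Y`.
    directed : ∀ n → IsNat n → ∀ X → Stage A n X →
      ∀ Y → Y ∈ Z → ∃[ W ] (W ∈ Z × (X ⊆ W × Y ⊆ W))
    directed = nat-induction
      (∀′ (stage′ 2F 1F 0F ⇒′ ∀′ (0F ∈′ 4F ⇒′ ∃′ (0F ∈′ 5F ∧′
        ∀′ (0F ∈′ 3F ⇒′ 0F ∈′ 1F) ∧′ ∀′ (0F ∈′ 2F ⇒′ 0F ∈′ 1F))))) (A ∷ Z ∷ [])
      (λ e E X st Y Y∈Z → Y , Y∈Z , (λ z z∈X → ⊥-elim (stage-zero E st z z∈X)) , λ _ → id)
      suc-case
      where
      suc-case : ∀ n m → IsSucc m n →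
        (∀ X → Stage A n X → ∀ Y → Y ∈ Z → ∃[ W ] (W ∈ Z × (X ⊆ W × Y ⊆ W))) →
        ∀ X → Stage A m X → ∀ Y → Y ∈ Z → ∃[ W ] (W ∈ Z × (X ⊆ W × Y ⊆ W))
      suc-case n m S IH X st Y Y∈Z =
        let (X₀ , st₀ , step₀)         = stage-pred S st
            (W₀ , W₀∈Z , X₀⊆W₀ , Y⊆W₀) = IH X₀ st₀ Y Y∈Z
            (W , step)                 = step-exists A W₀
        in W , closed W₀∈Z step , step-monotone X₀⊆W₀ step₀ step ,
           λ z z∈Y → from (step z) (inj₂ (inj₁ (Y⊆W₀ z z∈Y)))

    base : A ∈ U
    base =
      let (e , emp)  = empty-exists
          (X , st)   = stage-total A e (nat-zero emp)
          (Y , step) = step-exists A X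
      in from (E A) (Y , closed (from (D X) (e , nat-zero emp , st)) step , from (step A) (inj₁ refl))

    transitive : IsTransitive U
    transitive z z∈U u u∈z =
      let (X , X∈Z , z∈X) = to (E z) z∈U
          (Y , step)      = step-exists A X
      in from (E u) (Y , closed X∈Z step , from (step u) (inj₂ (inj₂ (inj₁ (z , z∈X , u∈z)))))

    upaired : ∀ {p x y} → IsUPair p x y → x ∈ U → y ∈ U → p ∈ U
    upaired {p} {x} {y} P x∈U y∈U =
      let (X , X∈Z , x∈X)         = to (E x) x∈U
          (Y , Y∈Z , y∈Y)         = to (E y) y∈U
          (n , nat , st)          = to (D X) X∈Z
          (W , W∈Z , X⊆W , Y⊆W) = directed n nat X st Y Y∈Z
          (W′ , step)             = step-exists A W
      in from (E p) (W′ , closed W∈Z step ,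
           from (step p) (inj₂ (inj₂ (inj₂ (upair-⊆ P (X⊆W x x∈X) (Y⊆W y y∈Y))))))

  -- Codes of formulas, uniformly in the tag

  -- Components that are variable indices must be naturals, and components that are formulas must
  -- satisfy `P`; a negation code repeats its component, hence the equation. Membership in a closed
  -- set, `IsFormula` and induction hypotheses all occur as `P`, so most arguments treat the five
  -- tags at once.
  Parts : Fin 5 → (V → Set ℓ) → V → V → Set ℓ
  Parts 0F P a b = IsNat a × IsNat b
  Parts 1F P a b = IsNat a × IsNat b
  Parts 2F P a b = P a × a ≡ b
  Parts 3F P a b = P a × P b
  Parts 4F P a b = IsNat a × P b

  Child : Fin 5 → V → V → V → Set ℓ
  Child 0F a b d = ¬ (d ≡ d)
  Child 1F a b d = ¬ (d ≡ d)
  Child 2F a b d = d ≡ a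
  Child 3F a b d = d ≡ a ⊎ d ≡ b
  Child 4F a b d = d ≡ b

  parts-map : ∀ k {P Q : V → Set ℓ} {a b} → (∀ x → P x → Q x) → Parts k P a b → Parts k Q a b
  parts-map 0F f h         = h
  parts-map 1F f h         = h
  parts-map 2F f (pa , e)  = f _ pa , e
  parts-map 3F f (pa , pb) = f _ pa , f _ pb
  parts-map 4F f (na , pb) = na , f _ pb

  parts-child : ∀ k {P : V → Set ℓ} {a b d} → Parts k P a b → Child k a b d → P d
  parts-child 0F h         c           = ⊥-elim (c refl)
  parts-child 1F h         c           = ⊥-elim (c refl)
  parts-child 2F (pa , _)  refl        = pa
  parts-child 3F (pa , pb) (inj₁ refl) = pa
  parts-child 3F (pa , pb) (inj₂ refl) = pb
  parts-child 4F (_ , pb)  refl        = pb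

  parts-both : ∀ k {P : V → Set ℓ} {a b} → (∀ x → IsNat x → P x) → Parts k P a b → P a × P b
  parts-both 0F nat (na , nb)   = nat _ na , nat _ nb
  parts-both 1F nat (na , nb)   = nat _ na , nat _ nb
  parts-both 2F nat (pa , refl) = pa , pa
  parts-both 3F nat h           = h
  parts-both 4F nat (na , pb)   = nat _ na , pb

  formulaClosed⇔ : ∀ {X} → IsFormulaClosed X ⇔
    (∀ k c a b → Parts k (_∈ X) a b → IsTagged (toℕ k) c a b → c ∈ X)
  formulaClosed⇔ {X} = mk⇔ f g
    where
    f : IsFormulaClosed X → ∀ k c a b → Parts k (_∈ X) a b → IsTagged (toℕ k) c a b → c ∈ X
    f (h , _)             0F c a b (na , nb)   t = h c a b na nb t
    f (_ , h , _)         1F c a b (na , nb)   t = h c a b na nb t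
    f (_ , _ , h , _)     2F c a b (pa , refl) t = h c a pa t
    f (_ , _ , _ , h , _) 3F c a b (pa , pb)   t = h c a b pa pb t
    f (_ , _ , _ , _ , h) 4F c a b (na , pb)   t = h c a b na pb t
    g : (∀ k c a b → Parts k (_∈ X) a b → IsTagged (toℕ k) c a b → c ∈ X) → IsFormulaClosed X
    g h = (λ c i j ni nj → h 0F c i j (ni , nj)) , (λ c i j ni nj → h 1F c i j (ni , nj)) ,
          (λ c φ pφ → h 2F c φ φ (pφ , refl)) , (λ c φ ψ pφ pψ → h 3F c φ ψ (pφ , pψ)) ,
          (λ c i φ ni pφ → h 4F c i φ (ni , pφ))

  formula-intro : ∀ k {c a b} → Parts k IsFormula a b → IsTagged (toℕ k) c a b → IsFormula c
  formula-intro k parts t X closed =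
    to formulaClosed⇔ closed k _ _ _ (parts-map k (λ _ fm → fm X closed) parts) t

  -- `IsFormula` is an intersection over all formula-closed sets, so one such set has to be
  -- exhibited. The hull of ω is one: it contains all naturals, hence tags and variable indices, and
  -- is closed under ordered pairs.
  formulas : ∃[ F ] (∀ c → c ∈ F ⇔ IsFormula c)
  formulas =
    let (w , W) = omega-exists
        (U , H) = hull w
        open Hull H
        nat∈U : ∀ n → IsNat n → n ∈ U
        nat∈U n nat = transitive w base n (from (W n) nat)
        closed : IsFormulaClosed U
        closed = from formulaClosed⇔ (λ { k c a b parts (t , p , N , P , C) →
          let (a∈U , b∈U) = parts-both k nat∈U parts
          in paired C (nat∈U t (numeral-nat (toℕ k) N)) (paired P a∈U b∈U) })
        (F , D) = separation (formula′ 0F) [] U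
    in F , λ c → mk⇔ (λ c∈F → proj₂ (to (D c) c∈F)) (λ fm → from (D c) (fm U closed , fm))

  formula-induction : ∀ {n} (φ : Formula (suc n)) (ρ : Vec V n) →
    (∀ k c a b → IsTagged (toℕ k) c a b → Parts k IsFormula a b →
       Parts k (λ x → x ∷ ρ ⊨ φ) a b → c ∷ ρ ⊨ φ) →
    ∀ c → IsFormula c → c ∷ ρ ⊨ φ
  formula-induction φ ρ step c fm =
    let (F , F⇔) = formulas
        (X , X⇔) = separation φ ρ F
        closed : IsFormulaClosed X
        closed = from formulaClosed⇔ (λ k c a b parts t →
          let parts-fm = parts-map k (λ x x∈X → to (F⇔ x) (proj₁ (to (X⇔ x) x∈X))) parts
              parts-φ  = parts-map k (λ x x∈X → proj₂ (to (X⇔ x) x∈X)) parts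
          in from (X⇔ c) (from (F⇔ c) (formula-intro k parts-fm t) , step k c a b t parts-fm parts-φ))
    in proj₂ (to (X⇔ c) (fm X closed))

  -- Written as five conjuncts because a quantifier over `Fin 5` is not expressible by a `Formula`;
  -- in this form it is what `byTag′` computes to.
  ByTag : (Fin 5 → V → V → Set ℓ) → V → Set ℓ
  ByTag Q c = tag 0F × tag 1F × tag 2F × tag 3F × tag 4F
    where
    tag : Fin 5 → Set ℓ
    tag k = ∀ a b → IsTagged (toℕ k) c a b → Q k a b

  byTag⇔ : ∀ {Q c} → ByTag Q c ⇔ (∀ k a b → IsTagged (toℕ k) c a b → Q k a b)
  byTag⇔ {Q} {c} = mk⇔ f (λ h → h 0F , h 1F , h 2F , h 3F , h 4F)
    where
    f : ByTag Q c → ∀ k a b → IsTagged (toℕ k) c a b → Q k a b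
    f (h , _)             0F = h
    f (_ , h , _)         1F = h
    f (_ , _ , h , _)     2F = h
    f (_ , _ , _ , h , _) 3F = h
    f (_ , _ , _ , _ , h) 4F = h

  -- Unique readability: a code has one tag and one pair of components, so the conjuncts for the
  -- other tags hold vacuously.
  byTag-tagged : ∀ k {Q c a b} → IsTagged (toℕ k) c a b → ByTag Q c ⇔ Q k a b
  byTag-tagged k {Q} {c} {a} {b} t = mk⇔ (λ h → to (byTag⇔ {Q}) h k a b t)
    (λ q → from (byTag⇔ {Q}) (λ l a′ b′ t′ → transport q (tagged-injective k l t t′)))
    where
    transport : ∀ {l a′ b′} → Q k a b → k ≡ l × a ≡ a′ × b ≡ b′ → Q l a′ b′
    transport q (refl , refl , refl) = q

  ChildrenIn : V → V → Set ℓ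
  ChildrenIn c D = ByTag (λ k a b → ∀ d → Child k a b d → d ∈ D) c

  childrenIn⇔ : ∀ {c D} → ChildrenIn c D ⇔
    (∀ k a b → IsTagged (toℕ k) c a b → ∀ d → Child k a b d → d ∈ D)
  childrenIn⇔ {c} {D} = byTag⇔ {λ k a b → ∀ d → Child k a b d → d ∈ D}

  -- Tarski's clauses for a truth predicate T

  Clause : Fin 5 → V → (V → V → Set ℓ) → V → V → V → Set ℓ
  Clause 0F M T a b s = ∃[ x ] ∃[ y ] (s ∋⟨ a , x ⟩ × s ∋⟨ b , y ⟩ × x ∈ y)
  Clause 1F M T a b s = ∃[ x ] ∃[ y ] (s ∋⟨ a , x ⟩ × s ∋⟨ b , y ⟩ × x ≡ y)
  Clause 2F M T a b s = ¬ T a s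
  Clause 3F M T a b s = T a s × T b s
  Clause 4F M T a b s = ∃[ x ] ∃[ t ] (x ∈ M × IsUpdate M t s a x × T b t)

  -- Negation is contravariant in the truth predicate, so even this one direction assumes an
  -- equivalence on the immediate subformulas.
  clause-map : ∀ k {M T T′ a b s} →
    (∀ d → Child k a b d → ∀ s → IsAssignment M s → T d s ⇔ T′ d s) →
    IsAssignment M s → Clause k M T a b s → Clause k M T′ a b s
  clause-map 0F h as c         = c
  clause-map 1F h as c         = c
  clause-map 2F h as c         = λ Tas → c (from (h _ refl _ as) Tas)
  clause-map 3F h as (ca , cb) = to (h _ (inj₁ refl) _ as) ca , to (h _ (inj₂ refl) _ as) cb
  clause-map 4F h as (x , t , x∈M , upd , c) =
    x , t , x∈M , upd , to (h _ refl _ (proj₁ upd)) c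

  clause-cong : ∀ k {M T T′ a b s} →
    (∀ d → Child k a b d → ∀ s → IsAssignment M s → T d s ⇔ T′ d s) →
    IsAssignment M s → Clause k M T a b s ⇔ Clause k M T′ a b s
  clause-cong k h as =
    mk⇔ (clause-map k h as) (clause-map k (λ d ch s as → ⇔-sym (h d ch s as)) as)

  Eval : V → V → V → V → Set ℓ
  Eval M S c s = ByTag (λ k a b → Clause k M (S ∋⟨_,_⟩) a b s) c

  eval-tagged : ∀ k {M S c a b s} → IsTagged (toℕ k) c a b →
    Eval M S c s ⇔ Clause k M (S ∋⟨_,_⟩) a b s
  eval-tagged k {M} {S} {s = s} = byTag-tagged k {λ k a b → Clause k M (S ∋⟨_,_⟩) a b s}

  eval-cong : ∀ {M S S′ c D s} → ChildrenIn c D →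
    (∀ d → d ∈ D → ∀ s → IsAssignment M s → S ∋⟨ d , s ⟩ ⇔ S′ ∋⟨ d , s ⟩) →
    IsAssignment M s → Eval M S c s ⇔ Eval M S′ c s
  eval-cong {M} {S} {S′} {c} {D} {s} ch h as = mk⇔
    (λ e → from eval′⇔ (λ k a b t → to (clauses k t) (to eval⇔ e k a b t)))
    (λ e → from eval⇔ (λ k a b t → from (clauses k t) (to eval′⇔ e k a b t)))
    where
    eval⇔  = byTag⇔ {λ k a b → Clause k M (S ∋⟨_,_⟩) a b s} {c}
    eval′⇔ = byTag⇔ {λ k a b → Clause k M (S′ ∋⟨_,_⟩) a b s} {c}
    clauses : ∀ k {a b} → IsTagged (toℕ k) c a b →
      Clause k M (S ∋⟨_,_⟩) a b s ⇔ Clause k M (S′ ∋⟨_,_⟩) a b s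
    clauses k t = clause-cong k (λ d child → h d (to childrenIn⇔ ch k _ _ t d child)) as

  satisfaction⇔ : ∀ {M S} → IsSatisfaction M S ⇔
    (∀ k c a b s → Parts k IsFormula a b → IsTagged (toℕ k) c a b → IsAssignment M s →
       S ∋⟨ c , s ⟩ ⇔ Clause k M (S ∋⟨_,_⟩) a b s)
  satisfaction⇔ {M} {S} = mk⇔ f g
    where
    f : IsSatisfaction M S → ∀ k c a b s → Parts k IsFormula a b → IsTagged (toℕ k) c a b →
        IsAssignment M s → S ∋⟨ c , s ⟩ ⇔ Clause k M (S ∋⟨_,_⟩) a b s
    f (h , _)             0F c a b s (na , nb)   = h c a b s na nb
    f (_ , h , _)         1F c a b s (na , nb)   = h c a b s na nb
    f (_ , _ , h , _)     2F c a b s (fa , refl) = h c a s fa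
    f (_ , _ , _ , h , _) 3F c a b s (fa , fb)   = h c a b s fa fb
    f (_ , _ , _ , _ , h) 4F c a b s (na , fb)   = h c a b s na fb
    g : (∀ k c a b s → Parts k IsFormula a b → IsTagged (toℕ k) c a b → IsAssignment M s →
           S ∋⟨ c , s ⟩ ⇔ Clause k M (S ∋⟨_,_⟩) a b s) → IsSatisfaction M S
    g h = (λ c i j s ni nj → h 0F c i j s (ni , nj)) ,
          (λ c i j s ni nj → h 1F c i j s (ni , nj)) ,
          (λ c φ s fm → h 2F c φ φ s (fm , refl)) ,
          (λ c φ ψ s fm fm′ → h 3F c φ ψ s (fm , fm′)) ,
          (λ c i φ s ni fm → h 4F c i φ s (ni , fm))

  -- Relations and functions given by formulas

  product : ∀ A B → ∃[ P ] (∀ p → p ∈ P ⇔ (∃[ x ] ∃[ y ] (x ∈ A × y ∈ B × IsPair p x y)))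
  product A B =
    let (u , U) = binary-union A B
        (v , W) = powerset u
        (w , X) = powerset v
        (P , D) = separation (∃′ ∃′ (1F ∈′ 3F ∧′ 0F ∈′ 4F ∧′ pair′ 2F 1F 0F)) (A ∷ B ∷ []) w
    in P , λ p → mk⇔ (λ p∈P → proj₂ (to (D p) p∈P))
      (λ { h@(x , y , x∈A , y∈B , a , b , Q , R , S) →
        let x∈u = from (U x) (inj₁ x∈A)
            y∈u = from (U y) (inj₂ y∈B)
        in from (D p) (from (X p) (upair-⊆ S (from (W a) (upair-⊆ Q x∈u x∈u))
                                             (from (W b) (upair-⊆ R x∈u y∈u))) , h) })

  -- ψ has the pair itself as an additional variable, which it is meant to ignore.
  relation : ∀ {n} A B (Q : V → V → Set ℓ) (ψ : Formula (suc (suc (suc n)))) (ρ : Vec V n) →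
    (∀ {p x y} → (y ∷ x ∷ p ∷ ρ ⊨ ψ) ⇔ Q x y) →
    ∃[ R ] ((∀ x y → R ∋⟨ x , y ⟩ ⇔ (x ∈ A × y ∈ B × Q x y)) ×
            (∀ p → p ∈ R → ∃[ x ] ∃[ y ] (x ∈ A × y ∈ B × IsPair p x y)))
  relation A B Q ψ ρ ψ⇔Q =
    let (P , P⇔) = product A B
        (R , R⇔) = separation (∃′ ∃′ (pair′ 2F 1F 0F ∧′ ψ)) ρ P
        f : ∀ x y → R ∋⟨ x , y ⟩ → x ∈ A × y ∈ B × Q x y
        f = λ { x y (p , pxy , p∈R) → relation-inv (to (P⇔ p) (proj₁ (to (R⇔ p) p∈R))) pxy
                  (proj₂ (to (R⇔ p) p∈R)) }
    in R , (λ x y → mk⇔ (f x y) (λ { (x∈A , y∈B , q) →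
             let (p , pxy) = pair-exists x y
             in p , pxy , from (R⇔ p) (from (P⇔ p) (x , y , x∈A , y∈B , pxy) ,
                                       x , y , pxy , from ψ⇔Q q) })) ,
       (λ p p∈R → to (P⇔ p) (proj₁ (to (R⇔ p) p∈R)))
    where
    relation-inv : ∀ {p x y} → ∃[ x ] ∃[ y ] (x ∈ A × y ∈ B × IsPair p x y) → IsPair p x y →
      ∃[ x ] ∃[ y ] (IsPair p x y × (y ∷ x ∷ p ∷ ρ ⊨ ψ)) → x ∈ A × y ∈ B × Q x y
    relation-inv (_ , _ , x∈A , y∈B , p₁) pxy (_ , _ , p₂ , q)
      with pair-injective p₁ pxy | pair-injective p₂ pxy
    ... | refl , refl | refl , refl = x∈A , y∈B , to ψ⇔Q q

  function : ∀ {n} A B (Q : V → V → Set ℓ) (ψ : Formula (suc (suc (suc n)))) (ρ : Vec V n) →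
    (∀ {p x y} → (y ∷ x ∷ p ∷ ρ ⊨ ψ) ⇔ Q x y) →
    (∀ x → x ∈ A → ∃[ y ] (y ∈ B × Q x y)) →
    (∀ x y y′ → x ∈ A → Q x y → Q x y′ → y ≡ y′) →
    ∃[ f ] (IsFunction f A B × (∀ x y → f ∋⟨ x , y ⟩ ⇔ (x ∈ A × y ∈ B × Q x y)))
  function A B Q ψ ρ ψ⇔Q total functional =
    let (f , f⇔ , pairs) = relation A B Q ψ ρ ψ⇔Q
    in f , (pairs ,
            (λ x x∈A → let (y , y∈B , q) = total x x∈A in y , from (f⇔ x y) (x∈A , y∈B , q)) ,
            (λ x y y′ fxy fxy′ → functional x y y′ (proj₁ (to (f⇔ x y) fxy))
               (proj₂ (proj₂ (to (f⇔ x y) fxy))) (proj₂ (proj₂ (to (f⇔ x y′) fxy′))))) , f⇔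

  function-domain : ∀ {f A B x y} → IsFunction f A B → f ∋⟨ x , y ⟩ → x ∈ A × y ∈ B
  function-domain (pairs , _) (p , P , p∈f) with pairs p p∈f
  ... | x′ , y′ , x∈A , y∈B , P′ with pair-injective P P′
  ... | refl , refl = x∈A , y∈B

  omega-unique : ∀ {w w′} → IsOmega w → IsOmega w′ → w ≡ w′
  omega-unique W W′ = extensionality _ _ (λ z → ⇔-sym (W′ z) ⇔-∘ W z)

  assignments : ∀ M → ∃[ 𝒜 ] (∀ s → s ∈ 𝒜 ⇔ IsAssignment M s)
  assignments M =
    let (w , W) = omega-exists
        (P , P⇔) = product w M
        (𝒫 , 𝒫⇔) = powerset P
        (𝒜 , 𝒜⇔) = separation (assignment′ 1F 0F) (M ∷ []) 𝒫
        s⊆P : ∀ s → IsAssignment M s → s ⊆ P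
        s⊆P = λ { s (w′ , W′ , fun) p p∈s → from (P⇔ p)
          (subst (λ w → ∃[ x ] ∃[ y ] (x ∈ w × y ∈ M × IsPair p x y)) (omega-unique W′ W)
            (proj₁ fun p p∈s)) }
    in 𝒜 , λ s → mk⇔ (λ s∈𝒜 → proj₂ (to (𝒜⇔ s) s∈𝒜))
                      (λ as → from (𝒜⇔ s) (from (𝒫⇔ s) (s⊆P s as) , as))

  -- Existence and uniqueness of satisfaction relations

  -- S satisfies Tarski's clauses on the set D of formulas closed under immediate subformulas.
  Attempt : V → V → V → Set ℓ
  Attempt M D S =
      (∀ c → c ∈ D → IsFormula c × ChildrenIn c D)
    × (∀ c s → c ∈ D → IsAssignment M s → S ∋⟨ c , s ⟩ ⇔ Eval M S c s)

  Agree : V → V → V → V → Set ℓ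
  Agree M S S′ c = ∀ s → IsAssignment M s → S ∋⟨ c , s ⟩ ⇔ S′ ∋⟨ c , s ⟩

  -- Both domains are closed under immediate subformulas, so the induction hypothesis applies to the
  -- subformulas of `c`, and both relations evaluate `c` by the same clause.
  attempts-agree : ∀ {M D S D′ S′} → Attempt M D S → Attempt M D′ S′ →
    ∀ c → IsFormula c → c ∈ D → c ∈ D′ → Agree M S S′ c
  attempts-agree {M} {D} {S} {D′} {S′} att att′ = formula-induction
    (0F ∈′ 2F ⇒′ 0F ∈′ 4F ⇒′ ∀′ (assignment′ 2F 0F ⇒′ (at′ 4F 1F 0F ⇔′ at′ 6F 1F 0F)))
    (M ∷ D ∷ S ∷ D′ ∷ S′ ∷ []) step
    where
    IH : V → Set ℓ
    IH c = c ∈ D → c ∈ D′ → Agree M S S′ c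
    step : ∀ k c a b → IsTagged (toℕ k) c a b → Parts k IsFormula a b → Parts k IH a b → IH c
    step k c a b t _ parts c∈D c∈D′ s as =
      ⇔-sym (proj₂ att′ c s c∈D′ as) ⇔-∘ (⇔-sym (eval-tagged k t) ⇔-∘
      (clause-cong k agree as ⇔-∘ (eval-tagged k t ⇔-∘ proj₂ att c s c∈D as)))
      where
      agree : ∀ d → Child k a b d → Agree M S S′ d
      agree d ch = parts-child k parts ch
        (to childrenIn⇔ (proj₂ (proj₁ att c c∈D)) k a b t d ch)
        (to childrenIn⇔ (proj₂ (proj₁ att′ c c∈D′)) k a b t d ch)

  satisfaction-unique : ∀ {M S S′} → IsSatisfaction M S → IsSatisfaction M S′ →
    ∀ c → IsFormula c → Agree M S S′ c
  satisfaction-unique {M} {S} {S′} sat sat′ = formula-induction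
    (∀′ (assignment′ 2F 0F ⇒′ (at′ 3F 1F 0F ⇔′ at′ 4F 1F 0F))) (M ∷ S ∷ S′ ∷ [])
    (λ k c a b t parts IH s as → ⇔-sym (to satisfaction⇔ sat′ k c a b s parts t as) ⇔-∘
      (clause-cong k (λ d → parts-child k IH) as ⇔-∘ to satisfaction⇔ sat k c a b s parts t as))

  attempt-set : ∀ M 𝒟 𝒮 → ∃[ R ] (∀ D S → R ∋⟨ D , S ⟩ ⇔ (D ∈ 𝒟 × S ∈ 𝒮 × Attempt M D S))
  attempt-set M 𝒟 𝒮 =
    let (R , R⇔ , _) = relation 𝒟 𝒮 (Attempt M) (attempt′ 3F 1F 0F) (M ∷ []) (⇔-id _) in R , R⇔

  eval-set : ∀ M S A B → ∃[ T ] ((∀ c s → T ∋⟨ c , s ⟩ ⇔ (c ∈ A × s ∈ B × Eval M S c s)) ×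
                                 (∀ p → p ∈ T → ∃[ c ] ∃[ s ] (c ∈ A × s ∈ B × IsPair p c s)))
  eval-set M S A B = relation A B (Eval M S) (eval′ 3F 4F 1F 0F) (M ∷ S ∷ []) (⇔-id _)

  union-domain : ∀ R F →
    ∃[ D∞ ] (∀ c → c ∈ D∞ ⇔ (c ∈ F × ∃[ D ] ∃[ S ] (R ∋⟨ D , S ⟩ × c ∈ D)))
  union-domain R F = separation (∃′ ∃′ (at′ 3F 1F 0F ∧′ 2F ∈′ 1F)) (R ∷ []) F

  union-truth : ∀ R F 𝒜 → ∃[ S∞ ] (∀ c s → S∞ ∋⟨ c , s ⟩ ⇔
    (c ∈ F × s ∈ 𝒜 × ∃[ D ] ∃[ S ] (R ∋⟨ D , S ⟩ × c ∈ D × S ∋⟨ c , s ⟩)))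
  union-truth R F 𝒜 =
    let (S∞ , S∞⇔ , _) = relation F 𝒜 (λ c s → ∃[ D ] ∃[ S ] (R ∋⟨ D , S ⟩ × c ∈ D × S ∋⟨ c , s ⟩))
          (∃′ ∃′ (at′ 5F 1F 0F ∧′ 3F ∈′ 1F ∧′ at′ 0F 3F 2F)) (R ∷ []) (⇔-id _)
    in S∞ , S∞⇔

  -- Let D∞ and S∞ be the unions of the attempts in R.  Applying Tarski's clauses to them once
  -- more yields another attempt ⟨D′ , S′⟩, so D∞ contains every formula whose immediate
  -- subformulas it contains.
  union-satisfaction : ∀ {M F 𝒜 R D∞ S∞ D′ S′} →
    (∀ c → c ∈ F ⇔ IsFormula c) →
    (∀ s → s ∈ 𝒜 ⇔ IsAssignment M s) →
    (∀ {D S} → R ∋⟨ D , S ⟩ → Attempt M D S) →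
    (∀ c → c ∈ D∞ ⇔ (c ∈ F × ∃[ D ] ∃[ S ] (R ∋⟨ D , S ⟩ × c ∈ D))) →
    (∀ c s → S∞ ∋⟨ c , s ⟩ ⇔
      (c ∈ F × s ∈ 𝒜 × ∃[ D ] ∃[ S ] (R ∋⟨ D , S ⟩ × c ∈ D × S ∋⟨ c , s ⟩))) →
    (∀ c → c ∈ D′ ⇔ (c ∈ F × ChildrenIn c D∞)) →
    (∀ c s → S′ ∋⟨ c , s ⟩ ⇔ (c ∈ F × s ∈ 𝒜 × Eval M S∞ c s)) →
    (Attempt M D′ S′ → R ∋⟨ D′ , S′ ⟩) →
    IsSatisfaction M S∞
  union-satisfaction {M} {F} {𝒜} {R} {D∞} {S∞} {D′} {S′} F⇔ 𝒜⇔ attempt D∞⇔ S∞⇔ D′⇔ S′⇔ R-closed =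
    from satisfaction⇔ clauses
    where
    S∞-agrees : ∀ {D S c} → R ∋⟨ D , S ⟩ → c ∈ D → Agree M S∞ S c
    S∞-agrees {D} {S} {c} r c∈D s as = mk⇔
      (λ h → let (c∈F , s∈𝒜 , D′ , S′ , r′ , c∈D′ , h′) = to (S∞⇔ c s) h
             in to (attempts-agree (attempt r′) (attempt r) c (to (F⇔ c) c∈F) c∈D′ c∈D s as) h′)
      (λ h → from (S∞⇔ c s) (from (F⇔ c) (proj₁ (proj₁ (attempt r) c c∈D)) , from (𝒜⇔ s) as ,
                             D , S , r , c∈D , h))

    D⊆D∞ : ∀ {D S} → R ∋⟨ D , S ⟩ → D ⊆ D∞
    D⊆D∞ {D} {S} r c c∈D =
      from (D∞⇔ c) (from (F⇔ c) (proj₁ (proj₁ (attempt r) c c∈D)) , D , S , r , c∈D)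

    attempt∞ : Attempt M D∞ S∞
    attempt∞ =
      (λ c c∈D∞ → let (c∈F , D , S , r , c∈D) = to (D∞⇔ c) c∈D∞
        in to (F⇔ c) c∈F , from childrenIn⇔ (λ k a b t d ch →
             D⊆D∞ r d (to childrenIn⇔ (proj₂ (proj₁ (attempt r) c c∈D)) k a b t d ch))) ,
      (λ c s c∈D∞ as → let (c∈F , D , S , r , c∈D) = to (D∞⇔ c) c∈D∞
        in ⇔-sym (eval-cong (proj₂ (proj₁ (attempt r) c c∈D)) (λ d → S∞-agrees r) as) ⇔-∘
           (proj₂ (attempt r) c s c∈D as ⇔-∘ S∞-agrees r c∈D s as))

    S′-eval : ∀ c s → c ∈ F → IsAssignment M s → S′ ∋⟨ c , s ⟩ ⇔ Eval M S∞ c s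
    S′-eval c s c∈F as = mk⇔ (λ h → proj₂ (proj₂ (to (S′⇔ c s) h)))
                             (λ e → from (S′⇔ c s) (c∈F , from (𝒜⇔ s) as , e))

    D∞⊆D′ : D∞ ⊆ D′
    D∞⊆D′ c c∈D∞ = from (D′⇔ c) (proj₁ (to (D∞⇔ c) c∈D∞) , proj₂ (proj₁ attempt∞ c c∈D∞))

    attempt′∞ : Attempt M D′ S′
    attempt′∞ =
      (λ c c∈D′ → let (c∈F , ch) = to (D′⇔ c) c∈D′
        in to (F⇔ c) c∈F , from childrenIn⇔ (λ k a b t d child →
             D∞⊆D′ d (to childrenIn⇔ ch k a b t d child))) ,
      -- `S′` evaluates by `S∞`, whereas an attempt must evaluate by itself. The two evaluations
      -- coincide because the subformulas lie in `D∞`, where `attempt∞` identifies `S∞` with `S′`.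
      (λ c s c∈D′ as → let (c∈F , ch) = to (D′⇔ c) c∈D′
        in eval-cong ch (λ d d∈D∞ s as →
             ⇔-sym (S′-eval d s (proj₁ (to (D∞⇔ d) d∈D∞)) as) ⇔-∘ proj₂ attempt∞ d s d∈D∞ as) as
           ⇔-∘ S′-eval c s c∈F as)

    children : ∀ k {c a b} → IsTagged (toℕ k) c a b → Parts k (_∈ D∞) a b → ChildrenIn c D∞
    children k t parts = from (byTag-tagged k {λ k a b → ∀ d → Child k a b d → d ∈ D∞} t)
      (λ d → parts-child k parts)

    all-formulas : ∀ c → IsFormula c → c ∈ D∞
    all-formulas = formula-induction (0F ∈′ 1F) (D∞ ∷ []) (λ k c a b t parts IH →
      D⊆D∞ (R-closed attempt′∞) c (from (D′⇔ c) (from (F⇔ c) (formula-intro k parts t) ,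
        children k t IH)))

    clauses : ∀ k c a b s → Parts k IsFormula a b → IsTagged (toℕ k) c a b → IsAssignment M s →
      S∞ ∋⟨ c , s ⟩ ⇔ Clause k M (S∞ ∋⟨_,_⟩) a b s
    clauses k c a b s parts t as = eval-tagged k t ⇔-∘
      proj₂ attempt∞ c s (all-formulas c (formula-intro k parts t)) as

  -- Domains are taken among subsets of `F` and relations among subsets of `F × 𝒜`, so the attempts
  -- form a set `R`. The further attempt `⟨D′ , S′⟩` respects the same bounds and is therefore a
  -- member of `R`.
  satisfaction-exists : ∀ M → ∃[ S ] IsSatisfaction M S
  satisfaction-exists M =
    let (F , F⇔)       = formulas
        (𝒜 , 𝒜⇔)      = assignments M
        (Π , Π⇔)       = product F 𝒜
        (𝒫F , 𝒫F⇔)    = powerset F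
        (𝒫Π , 𝒫Π⇔)    = powerset Π
        (R , R⇔)       = attempt-set M 𝒫F 𝒫Π
        (D∞ , D∞⇔)     = union-domain R F
        (S∞ , S∞⇔)     = union-truth R F 𝒜
        (D′ , D′⇔)     = separation (children′ 0F 1F) (D∞ ∷ []) F
        (S′ , S′⇔ , S′-pairs) = eval-set M S∞ F 𝒜
    in S∞ , union-satisfaction F⇔ 𝒜⇔ (λ {D} {S} h → proj₂ (proj₂ (to (R⇔ D S) h)))
         D∞⇔ S∞⇔ D′⇔ S′⇔
         (λ att → from (R⇔ D′ S′)
           ( from (𝒫F⇔ D′) (λ c c∈D′ → proj₁ (to (D′⇔ c) c∈D′))
           , from (𝒫Π⇔ S′) (λ p p∈S′ → from (Π⇔ p) (S′-pairs p p∈S′))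
           , att ))

  -- By uniqueness, the existential in `Satisfies` may be evaluated at any fixed satisfaction
  -- relation. Together with existence this gives Tarski's clauses for `Satisfies` itself, including
  -- the one for negation.
  satisfies⇔ : ∀ {M S} → IsSatisfaction M S → ∀ c s → IsFormula c → IsAssignment M s →
    Satisfies M c s ⇔ S ∋⟨ c , s ⟩
  satisfies⇔ {S = S} sat c s fm as = mk⇔
    (λ { (S′ , sat′ , h) → to (satisfaction-unique sat′ sat c fm s as) h })
    (λ h → S , sat , h)

  -- Assignments

  update-exists : ∀ {N s i x} → IsAssignment N s → IsNat i → x ∈ N → ∃[ t ] IsUpdate N t s i x
  update-exists {N} {s} {i} {x} (w , W , fun@(_ , total , functional)) nat x∈N =
    t , (w , W , t-fun) , from (t⇔ i x) (from (W i) nat , x∈N , inj₁ (refl , refl)) ,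
    λ k y nat-k k≢i → mk⇔ (λ h → other k≢i (proj₂ (proj₂ (to (t⇔ k y) h))))
      (λ h → from (t⇔ k y) (proj₁ (function-domain fun h) , proj₂ (function-domain fun h) ,
                             inj₂ (k≢i , h)))
    where
    Q : V → V → Set ℓ
    Q k y = (k ≡ i × y ≡ x) ⊎ (k ≢ i × s ∋⟨ k , y ⟩)
    other : ∀ {k y} → k ≢ i → Q k y → s ∋⟨ k , y ⟩
    other k≢i (inj₁ (k≡i , _)) = ⊥-elim (k≢i k≡i)
    other k≢i (inj₂ (_ , h))   = h
    Q-total : ∀ k → k ∈ w → ∃[ y ] (y ∈ N × Q k y)
    Q-total k k∈w with k ≟ i
    ... | yes k≡i = x , x∈N , inj₁ (k≡i , refl)
    ... | no  k≢i = let (y , h) = total k k∈w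
                    in y , proj₂ (function-domain fun h) , inj₂ (k≢i , h)
    Q-functional : ∀ k y y′ → k ∈ w → Q k y → Q k y′ → y ≡ y′
    Q-functional k y y′ _ (inj₁ (_ , refl))  (inj₁ (_ , refl))  = refl
    Q-functional k y y′ _ (inj₁ (k≡i , _))   (inj₂ (k≢i , _))   = ⊥-elim (k≢i k≡i)
    Q-functional k y y′ _ (inj₂ (k≢i , _))   (inj₁ (k≡i , _))   = ⊥-elim (k≢i k≡i)
    Q-functional k y y′ _ (inj₂ (_ , h))     (inj₂ (_ , h′))    = functional k y y′ h h′
    graph = function w N Q
      ((1F ≡′ 3F ∧′ 0F ≡′ 4F) ∨′ (¬′ (1F ≡′ 3F) ∧′ at′ 5F 1F 0F)) (i ∷ x ∷ s ∷ []) (⇔-id _)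
      Q-total Q-functional
    t     = proj₁ graph
    t-fun = proj₁ (proj₂ graph)
    t⇔    = proj₂ (proj₂ graph)

  constant-exists : ∀ {N x} → x ∈ N →
    ∃[ s ] (IsAssignment N s × (∀ k → IsNat k → s ∋⟨ k , x ⟩) × (∀ k y → s ∋⟨ k , y ⟩ → y ≡ x))
  constant-exists {N} {x} x∈N =
    let (w , W) = omega-exists
        (s , fun , s⇔) = function w N (λ k y → y ≡ x) (0F ≡′ 3F) (x ∷ []) (⇔-id _)
          (λ k _ → x , x∈N , refl) (λ { _ _ _ _ refl refl → refl })
    in s , (w , W , fun) , (λ k nat → from (s⇔ k x) (from (W k) nat , x∈N , refl)) ,
       (λ k y h → proj₂ (proj₂ (to (s⇔ k y) h)))

  assignment-value : ∀ {N s k x} → IsAssignment N s → s ∋⟨ k , x ⟩ → IsNat k × x ∈ N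
  assignment-value (w , W , fun) h =
    let (k∈w , x∈N) = function-domain fun h in to (W _) k∈w , x∈N

  assignment-functional : ∀ {N s k x y} → IsAssignment N s → s ∋⟨ k , x ⟩ → s ∋⟨ k , y ⟩ → x ≡ y
  assignment-functional (_ , _ , _ , _ , functional) = functional _ _ _

  assignment-range : ∀ {M N s} → (∀ k x → s ∋⟨ k , x ⟩ → x ∈ M) → IsAssignment N s → IsAssignment M s
  assignment-range {M} {N} {s} range (w , W , pairs , total , functional) =
    w , W , pairs′ , total , functional
    where
    pairs′ : ∀ p → p ∈ s → ∃[ x ] ∃[ y ] (x ∈ w × y ∈ M × IsPair p x y)
    pairs′ p p∈s = let (x , y , x∈w , _ , P) = pairs p p∈s
                   in x , y , x∈w , range x y (p , P , p∈s) , P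

  assignment-mono : ∀ {M N s} → M ⊆ N → IsAssignment M s → IsAssignment N s
  assignment-mono M⊆N as =
    assignment-range (λ k x h → M⊆N x (proj₂ (assignment-value as h))) as

  update-mono : ∀ {M N t s i x} → M ⊆ N → IsUpdate M t s i x → IsUpdate N t s i x
  update-mono M⊆N (as , upd) = assignment-mono M⊆N as , upd

  update-range : ∀ {M N t s i x} → IsAssignment M s → x ∈ M → IsUpdate N t s i x → IsUpdate M t s i x
  update-range {M} {N} {t} {s} {i} {x} as x∈M (at , hit , miss) =
    assignment-range range at , hit , miss
    where
    range : ∀ k y → t ∋⟨ k , y ⟩ → y ∈ M
    range k y h with k ≟ i
    ... | yes refl = subst (_∈ M) (assignment-functional at hit h) x∈M
    ... | no k≢i   = proj₂ (assignment-value as (to (miss k y (proj₁ (assignment-value at h)) k≢i) h))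

  -- Definability over ⟨N,∈⟩

  -- P is defined over ⟨N,∈⟩ by a formula with its free variables among v_k, k in ks.
  Definable : V → ∀ {m} → Vec V m → (Vec V m → Set ℓ) → Set ℓ
  Definable N {m} ks P = ∃[ c ] (IsFormula c × (∀ s xs → IsAssignment N s →
    (∀ p → s ∋⟨ lookup ks p , lookup xs p ⟩) → Satisfies N c s ⇔ P xs))

  satisfies-clause : ∀ k {M c a b s} → Parts k IsFormula a b → IsTagged (toℕ k) c a b →
    IsAssignment M s → Satisfies M c s ⇔ Clause k M (Satisfies M) a b s
  satisfies-clause k {M} {c} {a} {b} {s} parts t as =
    let (S , sat) = satisfaction-exists M
    in clause-cong k (λ d ch s′ as′ → ⇔-sym (satisfies⇔ sat d s′ (parts-child k parts ch) as′)) as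
       ⇔-∘ (to satisfaction⇔ sat k c a b s parts t as
       ⇔-∘ satisfies⇔ sat c s (formula-intro k parts t) as)

  definable-∈ : ∀ {N m} (ks : Vec V m) (p q : Fin m) → (∀ r → IsNat (lookup ks r)) →
    Definable N ks (λ xs → lookup xs p ∈ lookup xs q)
  definable-∈ ks p q nats =
    let (c , t) = tagged-exists 0 (lookup ks p) (lookup ks q)
    in c , formula-intro 0F (nats p , nats q) t , λ s xs as vals →
       mk⇔ (λ { (x , y , hx , hy , x∈y) →
                subst (λ x → x ∈ lookup xs q) (assignment-functional as hx (vals p))
                  (subst (x ∈_) (assignment-functional as hy (vals q)) x∈y) })
           (λ h → lookup xs p , lookup xs q , vals p , vals q , h)
       ⇔-∘ satisfies-clause 0F (nats p , nats q) t as

  definable-¬ : ∀ {N m} (ks : Vec V m) {P} → Definable N ks P → Definable N ks (λ xs → ¬ P xs)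
  definable-¬ ks (φ , fm , φ⇔P) =
    let (c , t) = tagged-exists 2 φ φ
    in c , formula-intro 2F (fm , refl) t , λ s xs as vals →
       ¬-cong-⇔ (φ⇔P s xs as vals) ⇔-∘ satisfies-clause 2F (fm , refl) t as

  definable-∧ : ∀ {N m} (ks : Vec V m) {P Q} → Definable N ks P → Definable N ks Q →
    Definable N ks (λ xs → P xs × Q xs)
  definable-∧ ks (φ , fm , φ⇔P) (ψ , fm′ , ψ⇔Q) =
    let (c , t) = tagged-exists 3 φ ψ
    in c , formula-intro 3F (fm , fm′) t , λ s xs as vals →
       (φ⇔P s xs as vals ×-⇔ ψ⇔Q s xs as vals) ⇔-∘ satisfies-clause 3F (fm , fm′) t as

  -- Freshness of `k` ensures that updating an assignment at `k` leaves the values of the free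
  -- variables `ks` intact.
  definable-∃ : ∀ {N m k} (ks : Vec V m) {P} → IsNat k → (∀ p → IsNat (lookup ks p)) →
    (∀ p → lookup ks p ≢ k) → Definable N (k ∷ ks) P →
    Definable N ks (λ xs → ∃[ x ] (x ∈ N × P (x ∷ xs)))
  definable-∃ {N} {m} {k} ks {P} nat nats fresh (φ , fm , φ⇔P) =
    let (c , t) = tagged-exists 4 k φ
    in c , formula-intro 4F (nat , fm) t , λ s xs as vals →
       mk⇔ (λ { (x , u , x∈N , upd , h) →
                x , x∈N , to (φ⇔P u (x ∷ xs) (proj₁ upd) (updated vals upd)) h })
           (λ { (x , x∈N , h) → let (u , upd) = update-exists as nat x∈N in
                x , u , x∈N , upd , from (φ⇔P u (x ∷ xs) (proj₁ upd) (updated vals upd)) h })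
       ⇔-∘ satisfies-clause 4F (nat , fm) t as
    where
    updated : ∀ {s u x xs} → (∀ p → s ∋⟨ lookup ks p , lookup xs p ⟩) → IsUpdate N u s k x →
      ∀ p → u ∋⟨ lookup (k ∷ ks) p , lookup (x ∷ xs) p ⟩
    updated vals (_ , hit , miss) 0F      = hit
    updated vals (_ , hit , miss) (suc p) = from (miss _ _ (nats p) (fresh p)) (vals p)

  -- A separate definition for each variable: relativizing a quantifier needs the definition in the
  -- variable just bound, and asking for all of them avoids substitution in codes. The index `i` may
  -- be nonstandard.
  DefinableClass : V → V → Set ℓ
  DefinableClass N M = ∀ i → IsNat i → Definable N (i ∷ []) (λ xs → lookup xs 0F ∈ M)

  -- Relativization to a definable class and restriction of elementary maps

  relativize : ∀ {M N} → M ⊆ N → DefinableClass N M → ∀ φ → IsFormula φ →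
    ∃[ φ′ ] (IsFormula φ′ × (∀ s → IsAssignment M s → Satisfies M φ s ⇔ Satisfies N φ′ s))
  relativize {M} {N} M⊆N def φ fm =
    -- The induction proves only that some translation exists, with the two satisfaction relations
    -- as parameters; no translation function on codes has to be constructed.
    let (φ′ , fm′ , eq) = formula-induction
          (∃′ (formula′ 0F ∧′ ∀′ (assignment′ 3F 0F ⇒′ (at′ 4F 2F 0F ⇔′ at′ 5F 1F 0F))))
          (M ∷ S ∷ S′ ∷ []) step φ fm
    in φ′ , fm′ , λ s as → ⇔-sym (satisfies⇔ sat′ φ′ s fm′ (assignment-mono M⊆N as)) ⇔-∘
                             (eq s as ⇔-∘ satisfies⇔ sat φ s fm as)
    where
    S    = proj₁ (satisfaction-exists M)
    sat  = proj₂ (satisfaction-exists M)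
    S′   = proj₁ (satisfaction-exists N)
    sat′ = proj₂ (satisfaction-exists N)

    Translates : V → V → Set ℓ
    Translates φ φ′ = ∀ s → IsAssignment M s → S ∋⟨ φ , s ⟩ ⇔ S′ ∋⟨ φ′ , s ⟩
    IH : V → Set ℓ
    IH φ = ∃[ φ′ ] (IsFormula φ′ × Translates φ φ′)

    tarski  = λ k {c a b s} parts t as → to satisfaction⇔ sat k c a b s parts t as
    tarski′ = λ k {c a b s} parts t as →
      to satisfaction⇔ sat′ k c a b s parts t (assignment-mono M⊆N as)

    step : ∀ k c a b → IsTagged (toℕ k) c a b → Parts k IsFormula a b → Parts k IH a b → IH c
    step 0F c a b t parts _ = c , formula-intro 0F parts t ,
      λ s as → ⇔-sym (tarski′ 0F parts t as) ⇔-∘ tarski 0F parts t as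
    step 1F c a b t parts _ = c , formula-intro 1F parts t ,
      λ s as → ⇔-sym (tarski′ 1F parts t as) ⇔-∘ tarski 1F parts t as
    step 2F c a b t parts ((a′ , fm , eq) , _) =
      let (c′ , t′) = tagged-exists 2 a′ a′
      in c′ , formula-intro 2F (fm , refl) t′ , λ s as →
         ⇔-sym (tarski′ 2F (fm , refl) t′ as) ⇔-∘ (¬-cong-⇔ (eq s as) ⇔-∘ tarski 2F parts t as)
    step 3F c a b t parts ((a′ , fm , eq) , b′ , fm′ , eq′) =
      let (c′ , t′) = tagged-exists 3 a′ b′
      in c′ , formula-intro 3F (fm , fm′) t′ , λ s as →
         ⇔-sym (tarski′ 3F (fm , fm′) t′ as) ⇔-∘ ((eq s as ×-⇔ eq′ s as) ⇔-∘ tarski 3F parts t as)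
    step 4F c i b t parts@(nat , _) (_ , b′ , fm′ , eq) =
      -- The code for `∃vᵢ φ` is translated to the one for `∃vᵢ (θ ∧ φ′)`, where `θ` defines `M` in
      -- the variable `vᵢ`.
      let (θ , fm-θ , θ⇔) = def i nat
          (d , t-d)   = tagged-exists 3 θ b′
          fm-d        = formula-intro 3F (fm-θ , fm′) t-d
          (c′ , t′)   = tagged-exists 4 i d
          in-M : ∀ u x → IsAssignment N u → u ∋⟨ i , x ⟩ → S′ ∋⟨ θ , u ⟩ ⇔ x ∈ M
          in-M = λ u x au h → θ⇔ u (x ∷ []) au (λ { 0F → h }) ⇔-∘
                              ⇔-sym (satisfies⇔ sat′ θ u fm-θ au)
      in c′ , formula-intro 4F (nat , fm-d) t′ , λ s as →
         ⇔-sym (tarski′ 4F (nat , fm-d) t′ as) ⇔-∘ (mk⇔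
           (λ { (x , u , x∈M , upd , h) →
                let upd′ = update-mono M⊆N upd in
                x , u , M⊆N x x∈M , upd′ ,
                from (to satisfaction⇔ sat′ 3F d θ b′ u (fm-θ , fm′) t-d (proj₁ upd′))
                  (from (in-M u x (proj₁ upd′) (proj₁ (proj₂ upd))) x∈M , to (eq u (proj₁ upd)) h) })
           -- Here `θ` forces the witness from `N` into `M`; the updated assignment then takes all
           -- its values in `M`, so the induction hypothesis applies to it.
           (λ { (x , u , x∈N , upd′ , h) →
                let (hθ , hb) = to (to satisfaction⇔ sat′ 3F d θ b′ u (fm-θ , fm′) t-d (proj₁ upd′)) h
                    x∈M       = to (in-M u x (proj₁ upd′) (proj₁ (proj₂ upd′))) hθ
                    upd       = update-range as x∈M upd′
                in x , u , x∈M , upd , from (eq u (proj₁ upd)) hb })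
         ⇔-∘ tarski 4F parts t as)

  -- Elementarity of `j` is used twice: for the formula defining `M`, which shows that `j` maps `M`
  -- into `M`, and for relativized formulas, which makes the restriction elementary.
  elementary-restriction : ∀ {M N} → M ⊆ N → DefinableClass N M → ∀ j → IsElementary j N N →
    ∃[ r ] (IsRestriction r j M × IsElementary r M M)
  elementary-restriction {M} {N} M⊆N def j (j-fun@(j-pairs , j-total , j-functional) , j-elem) =
    r , r⇔ , (r-pairs , r-total , r-functional) , r-elem
    where
    restriction : ∃[ r ] IsRestriction r j M
    restriction = separation (∃′ ∃′ (1F ∈′ 3F ∧′ pair′ 2F 1F 0F)) (M ∷ []) j
    r  = proj₁ restriction
    r⇔ = proj₂ restriction

    r⊆j : r ⊆ j
    r⊆j p p∈r = proj₁ (to (r⇔ p) p∈r)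

    restrict : ∀ {x y} → x ∈ M → j ∋⟨ x , y ⟩ → r ∋⟨ x , y ⟩
    restrict {x} {y} x∈M (p , P , p∈j) = p , P , from (r⇔ p) (p∈j , x , y , x∈M , P)

    preserves-M : ∀ {x y} → x ∈ M → j ∋⟨ x , y ⟩ → y ∈ M
    preserves-M {x} {y} x∈M jxy =
      let (e , E) = empty-exists
          nat = nat-zero E
          (θ , fm , θ⇔) = def e nat
          -- With `s` constantly `x`, the composite of `j` and `s` is constantly `y`, so commutation
          -- at every index reduces to the single value of `j` at `x`.
          (s , as , s-val , s-const) = constant-exists (M⊆N x x∈M)
          (t , at , t-val , _) = constant-exists (proj₂ (function-domain j-fun jxy))
          commutes : ∀ k u v → s ∋⟨ k , u ⟩ → j ∋⟨ u , v ⟩ → t ∋⟨ k , v ⟩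
          commutes = λ k u v sku juv → subst (λ v → t ∋⟨ k , v ⟩)
            (j-functional x y v jxy (subst (λ u → j ∋⟨ u , v ⟩) (s-const k u sku) juv))
            (t-val k (proj₁ (assignment-value as sku)))
      in to (θ⇔ t (y ∷ []) at (λ { 0F → t-val e nat }))
           (to (j-elem θ s t fm as at commutes)
             (from (θ⇔ s (x ∷ []) as (λ { 0F → s-val e nat })) x∈M))

    r-pairs : ∀ p → p ∈ r → ∃[ x ] ∃[ y ] (x ∈ M × y ∈ M × IsPair p x y)
    r-pairs p p∈r =
      let (p∈j , x , y , x∈M , P) = to (r⇔ p) p∈r
      in x , y , x∈M , preserves-M x∈M (p , P , p∈j) , P

    r-total : ∀ x → x ∈ M → ∃[ y ] r ∋⟨ x , y ⟩
    r-total x x∈M = let (y , jxy) = j-total x (M⊆N x x∈M) in y , restrict x∈M jxy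

    r-functional : ∀ x y y′ → r ∋⟨ x , y ⟩ → r ∋⟨ x , y′ ⟩ → y ≡ y′
    r-functional x y y′ h h′ = j-functional x y y′ (∋-mono r⊆j h) (∋-mono r⊆j h′)

    r-elem : ∀ φ s t → IsFormula φ → IsAssignment M s → IsAssignment M t →
      (∀ k x y → s ∋⟨ k , x ⟩ → r ∋⟨ x , y ⟩ → t ∋⟨ k , y ⟩) →
      Satisfies M φ s ⇔ Satisfies M φ t
    r-elem φ s t fm as at commutes =
      let (φ′ , fm′ , eq) = relativize M⊆N def φ fm
          elem = j-elem φ′ s t fm′ (assignment-mono M⊆N as) (assignment-mono M⊆N at)
            (λ k x y skx jxy → commutes k x y skx (restrict (proj₂ (assignment-value as skx)) jxy))
      in ⇔-sym (eq t at) ⇔-∘ (elem ⇔-∘ eq s as)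

  -- Y is the only element of U ∪ {U} ∪ {Y} that belongs to no element, and of the elements of
  -- Y only U belongs to no element of Y.
  extension-definable : ∀ {M U Y N} → IsTransitive U → M ⊆ U →
    (∀ z → z ∈ Y ⇔ (z ∈ M ⊎ z ≡ U)) → (∀ z → z ∈ N ⇔ (z ∈ U ⊎ (z ≡ U ⊎ z ≡ Y))) →
    IsTransitive N × DefinableClass N M
  extension-definable {M} {U} {Y} {N} U-trans M⊆U Y⇔ N⇔ = N-trans , defines
    where
    U⊆N : U ⊆ N
    U⊆N x x∈U = from (N⇔ x) (inj₁ x∈U)
    U∈N : U ∈ N
    U∈N = from (N⇔ U) (inj₂ (inj₁ refl))
    Y∈N : Y ∈ N
    Y∈N = from (N⇔ Y) (inj₂ (inj₂ refl))
    U∈Y : U ∈ Y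
    U∈Y = from (Y⇔ U) (inj₂ refl)

    N-trans : IsTransitive N
    N-trans y y∈N x x∈y with to (N⇔ _) y∈N
    ... | inj₁ y∈U         = U⊆N x (U-trans y y∈U x x∈y)
    ... | inj₂ (inj₁ refl) = U⊆N x x∈y
    ... | inj₂ (inj₂ refl) with to (Y⇔ x) x∈y
    ...   | inj₁ x∈M  = U⊆N x (M⊆U x x∈M)
    ...   | inj₂ refl = U∈N

    Maximal : V → Set ℓ
    Maximal y = ¬ (∃[ z ] (z ∈ N × y ∈ z))

    Y-maximal : Maximal Y
    Y-maximal (z , z∈N , Y∈z) with to (N⇔ _) z∈N
    ... | inj₁ z∈U         = no-2-cycle U∈Y (U-trans z z∈U Y Y∈z)
    ... | inj₂ (inj₁ refl) = no-2-cycle U∈Y Y∈z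
    ... | inj₂ (inj₂ refl) = no-1-cycle Y∈z

    maximal-unique : ∀ {y} → y ∈ N → Maximal y → y ≡ Y
    maximal-unique {y} y∈N max with to (N⇔ _) y∈N
    ... | inj₁ y∈U         = ⊥-elim (max (U , U∈N , y∈U))
    ... | inj₂ (inj₁ refl) = ⊥-elim (max (Y , Y∈N , U∈Y))
    ... | inj₂ (inj₂ y≡Y)  = y≡Y

    InM : V → Set ℓ
    InM x = ∃[ y ] (y ∈ N × Maximal y × x ∈ y × ∃[ u ] (u ∈ N × u ∈ y × x ∈ u))

    U∉Y-element : ∀ {u} → u ∈ Y → ¬ (U ∈ u)
    U∉Y-element {u} u∈Y U∈u with to (Y⇔ u) u∈Y
    ... | inj₁ u∈M  = no-2-cycle U∈u (M⊆U u u∈M)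
    ... | inj₂ refl = no-1-cycle U∈u

    inM⇔ : ∀ x → InM x ⇔ x ∈ M
    inM⇔ x = mk⇔ f (λ x∈M →
      Y , Y∈N , Y-maximal , from (Y⇔ x) (inj₁ x∈M) , U , U∈N , U∈Y , M⊆U x x∈M)
      where
      f : InM x → x ∈ M
      f (y , y∈N , max , x∈y , u , _ , u∈y , x∈u) with maximal-unique y∈N max
      ... | refl with to (Y⇔ x) x∈y
      ...   | inj₁ x∈M  = x∈M
      ...   | inj₂ refl = ⊥-elim (U∉Y-element u∈y x∈u)

    defines : DefinableClass N M
    defines i nat-i =
      -- The bound variables are the next two successors of `i`; Foundation makes them distinct from
      -- `i` and from each other, which gives freshness. Both inner quantifiers can share `l`
      -- because neither lies in the scope of the other.
      let (k , S)  = succ-exists i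
          (l , S′) = succ-exists k
          i∈k = succ-∋ S
          k∈l = succ-∋ S′
          i∈l = from (S′ i) (inj₁ i∈k)
          nat-k = nat-suc S nat-i
          nat-l = nat-suc S′ nat-k
          ks₁ = i ∷ []
          ks₂ = k ∷ ks₁
          ks₃ = l ∷ ks₂
          nats₁ : ∀ p → IsNat (lookup ks₁ p)
          nats₁ = λ { 0F → nat-i }
          nats₂ : ∀ p → IsNat (lookup ks₂ p)
          nats₂ = λ { 0F → nat-k ; 1F → nat-i }
          nats₃ : ∀ p → IsNat (lookup ks₃ p)
          nats₃ = λ { 0F → nat-l ; 1F → nat-k ; 2F → nat-i }
          fresh₂ : ∀ p → lookup ks₂ p ≢ l
          fresh₂ = λ { 0F → ∈⇒≢ k∈l ; 1F → ∈⇒≢ i∈l }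
          (θ , fm , θ⇔) = definable-∃ {N} ks₁ nat-k nats₁ (λ { 0F → ∈⇒≢ i∈k })
            (definable-∧ ks₂
              (definable-¬ ks₂ (definable-∃ ks₂ nat-l nats₂ fresh₂ (definable-∈ ks₃ 1F 0F nats₃)))
              (definable-∧ ks₂ (definable-∈ ks₂ 1F 0F nats₂)
                (definable-∃ ks₂ nat-l nats₂ fresh₂ (definable-∧ ks₃
                  (definable-∈ ks₃ 0F 1F nats₃) (definable-∈ ks₃ 2F 0F nats₃)))))
      in θ , fm , λ { s (x ∷ []) as vals → inM⇔ x ⇔-∘ θ⇔ s (x ∷ []) as vals }

  definable-extension : ∀ M a →
    ∃[ N ] ((IsTransitive N × DefinableClass N M) × M ⊆ N × a ∈ N)
  definable-extension M a =
    -- Seeding the hull with `{M , a}` puts both sets into `U` by transitivity, and a second use of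
    -- transitivity gives `M ⊆ U`.
    let (p , P)  = pairing M a
        (U , H)  = hull p
        open Hull H
        (Y , Y⇔) = adjoin M U
        (q , Q)  = pairing U Y
        (N , N⇔) = binary-union U q
        M⊆U      = transitive M (transitive p base M (upair-left P))
    in N ,
       extension-definable transitive M⊆U Y⇔
         (λ z → mk⇔ (λ z∈N → Sum.map₂ (to (Q z)) (to (N⇔ z) z∈N))
                    (λ h → from (N⇔ z) (Sum.map₂ (from (Q z)) h))) ,
       (λ z z∈M → from (N⇔ z) (inj₁ (M⊆U z z∈M))) ,
       from (N⇔ a) (inj₁ (transitive p base a (upair-right P)))

lemma2p3 : ∀ {ℓ} (𝓥 : Universe ℓ) (let open SetTheory 𝓥) →
    IsZF → ∀ δ → IsBerkeley δ → ProvidesPotentialistAccount (World δ) Accesses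
lemma2p3 𝓥 zf δ _ =
  (λ M _ → (λ _ _ → tt) ,
           (λ x y x∈M y∈M → mk⇔ (λ { (_ , _ , x∈y) → x∈y }) (λ x∈y → x∈M , y∈M , x∈y))) ,
  (λ { M (_ , δ∈M) a →
    let (N , (N-trans , def) , M⊆N , a∈N) = definable-extension M a
    in N , (N-trans , M⊆N δ δ∈M) , (M⊆N , elementary-restriction M⊆N def) , a∈N })
  where open ZF 𝓥 zf
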